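{- Let $G$ be a simple, undirected, connected graph on $N\ge 2$ vertices with edge set $E$ and degrees $d_i$, and let $$\sigma^2=\frac{2}{N}\sum_{(i,j)\in E}\frac{1}{d_id_j}=\frac{\mathrm{tr}(P^2)}{N},\qquad \sigma\ge 0.$$ Then $$R^+(G)\ge N\left[\frac{1}{1+\frac{\sigma}{\sqrt{N-1}}}+\frac{(N-2)^2}{N-1-\frac{\sigma}{\sqrt{N-1}}}\right]+(N-1)^2.$$
   Context: $P=(p(v,w))$ is the $N\times N$ transition matrix of the simple random walk on $G$: $p(v,w)=1/d_v$ if $v,w$ are adjacent and $0$ otherwise. For vertices $i,j$, $R_{ij}$ denotes the effective resistance between $i$ and $j$ when every edge is a unit resistor. The additive degree-Kirchhoff index is $R^+(G)=\sum_{i<j}(d_i+d_j)R_{ij}$.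
   Formalization: For N = 2 (only G = K_2, where σ = 1) the fraction (N-2)^2/(N-1-σ/√(N-1)) is 0/0 and undefined; it is read as 0 there. For N ≥ 3 the statement is as given. -}

module Defs where

open import Level using (0ℓ)
open import Data.Bool using (Bool; true; false; if_then_else_; _∧_)
open import Data.Empty using (⊥-elim)
open import Data.Fin using (Fin)
import Data.Fin as Fin
import Data.Integer as ℤ
import Data.Integer.Properties as ℤ
open import Data.Nat using (ℕ; zero; suc; _∸_)
import Data.Nat as ℕ
import Data.Nat.Properties as ℕ
open import Data.Product using (Σ; ∃; _×_; _,_; proj₁; proj₂)
open import Data.Rational
open import Data.Rational.Literals using (fromℤ)
open import Data.Rational.Properties
open import Data.Rational.Solver using (module +-*-Solver)
import Data.Rational.Unnormalised as ℚᵘ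
import Data.Rational.Unnormalised.Properties as ℚᵘ
open import Data.Sum using (inj₁; inj₂)
open import Relation.Binary using (Rel; Decidable; Symmetric)
open import Relation.Binary.Construct.Closure.ReflexiveTransitive using (Star)
open import Relation.Binary.PropositionalEquality hiding ([_])
open import Relation.Nullary using (¬_; Dec; yes; no; does)
open import Relation.Nullary.Decidable using (toWitness)
open import Algebra.Properties.CommutativeMonoid.Sum +-0-commutativeMonoid using (sum; sum-syntax)
import Algebra.Properties.CommutativeMonoid.Sum ℕ.+-0-commutativeMonoid as ℕΣ
open +-*-Solver using (solve; _:+_; _:*_; :-_; _:-_; _:=_; con)

fromℕ : ℕ → ℚ
fromℕ n = fromℤ (ℤ.+ n)

-- Reciprocal with inv 0 = 0.
inv : ℚ → ℚ
inv p with p ≟ 0ℚ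
... | yes _  = 0ℚ
... | no p≢0 = (1/ p) {{≢-nonZero p≢0}}

module ℚ-Lemmas where
  open ≤-Reasoning

  fromℕ-suc : ∀ n → fromℕ (suc n) ≡ 1ℚ + fromℕ n
  fromℕ-suc n = toℚᵘ-injective (ℚᵘ.≃-trans
    (ℚᵘ.*≡* (cong (λ z → ((ℤ.+ 1) ℤ.+ z) ℤ.* (ℤ.+ 1)) (sym (ℤ.*-identityʳ (ℤ.+ n)))))
    (ℚᵘ.≃-sym (toℚᵘ-homo-+ 1ℚ (fromℕ n))))

  fromℕ-mono : ∀ {m n} → m ℕ.≤ n → fromℕ m ≤ fromℕ n
  fromℕ-mono {m} {n} m≤n = *≤* (ℤ.*-monoʳ-≤-nonNeg (ℤ.+ 1) (ℤ.+≤+ m≤n))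

  0≤fromℕ : ∀ n → 0ℚ ≤ fromℕ n
  0≤fromℕ n = fromℕ-mono {0} {n} ℕ.z≤n

  archimedean : ∀ p → ∃ λ n → p ≤ fromℕ n
  archimedean p@(mkℚ (ℤ.+ n) d _)      = n , *≤* (ℤ.*-monoˡ-≤-nonNeg (ℤ.+ n) (ℤ.+≤+ (ℕ.s≤s ℕ.z≤n)))
  archimedean p@(mkℚ ℤ.-[1+ n ] d _) = 0 , *≤* ℤ.-≤+

  0≤+ : ∀ {p q} → 0ℚ ≤ p → 0ℚ ≤ q → 0ℚ ≤ p + q
  0≤+ {p} {q} = +-mono-≤ {0ℚ} {p} {0ℚ} {q}

  0≤* : ∀ {p q} → 0ℚ ≤ p → 0ℚ ≤ q → 0ℚ ≤ p * q
  0≤* {p} {q} a b = nonNegative⁻¹ _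
    {{nonNeg*nonNeg⇒nonNeg p {{nonNegative a}} q {{nonNegative b}}}}

  0<+ : ∀ {p q} → 0ℚ < p → 0ℚ < q → 0ℚ < p + q
  0<+ {p} {q} = +-mono-< {0ℚ} {p} {0ℚ} {q}

  0<* : ∀ {p q} → 0ℚ < p → 0ℚ < q → 0ℚ < p * q
  0<* {p} {q} a b = positive⁻¹ _ {{pos*pos⇒pos p {{positive a}} q {{positive b}}}}

  *-monoˡ : ∀ {r p q} → 0ℚ ≤ r → p ≤ q → r * p ≤ r * q
  *-monoˡ {r} a = *-monoˡ-≤-nonNeg r {{nonNegative a}}

  *-monoʳ : ∀ {r p q} → 0ℚ ≤ r → p ≤ q → p * r ≤ q * r
  *-monoʳ {r} a = *-monoʳ-≤-nonNeg r {{nonNegative a}}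

  *-mono : ∀ {p q r s} → 0ℚ ≤ r → 0ℚ ≤ q → p ≤ q → r ≤ s → p * r ≤ q * s
  *-mono a b c d = ≤-trans (*-monoʳ a c) (*-monoˡ b d)

  p≤p+q : ∀ {p q} → 0ℚ ≤ q → p ≤ p + q
  p≤p+q {p} h = ≤-trans (≤-reflexive (sym (+-identityʳ p))) (+-monoʳ-≤ p h)

  0≤inv : ∀ {p} → 0ℚ ≤ p → 0ℚ ≤ inv p
  0≤inv {p} h with p ≟ 0ℚ
  ... | yes _  = ≤-refl
  ... | no p≢0 = <⇒≤ (positive⁻¹ _ {{1/pos⇒pos p}})
    where instance 0<p = nonNeg∧nonZero⇒pos p {{nonNegative h}} {{≢-nonZero p≢0}}

  *-inv : ∀ {p} → 0ℚ < p → p * inv p ≡ 1ℚ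
  *-inv {p} h with p ≟ 0ℚ
  ... | yes p≡0 = ⊥-elim (<⇒≢ h (sym p≡0))
  ... | no p≢0  = *-inverseʳ p {{≢-nonZero p≢0}}

  *-inv≤1 : ∀ p → p * inv p ≤ 1ℚ
  *-inv≤1 p with p ≟ 0ℚ
  ... | yes _   = ≤-trans (≤-reflexive (*-zeroʳ p)) (nonNegative⁻¹ 1ℚ)
  ... | no p≢0  = ≤-reflexive (*-inverseʳ p {{≢-nonZero p≢0}})

  0<inv : ∀ {p} → 0ℚ < p → 0ℚ < inv p
  0<inv {p} h = ≰⇒> λ le → <-irrefl refl (begin-strict
    0ℚ        <⟨ positive⁻¹ 1ℚ ⟩
    1ℚ        ≡⟨ sym (*-inv h) ⟩
    p * inv p ≤⟨ *-monoˡ (<⇒≤ h) le ⟩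
    p * 0ℚ    ≡⟨ *-zeroʳ p ⟩
    0ℚ        ∎)

  inv≤ : ∀ {p c} → 0ℚ < p → 1ℚ ≤ p * c → inv p ≤ c
  inv≤ {p} {c} h le = *-cancelˡ-≤-pos p {{positive h}}
    (≤-trans (≤-reflexive (*-inv h)) le)

  half : ∀ p → ½ * p + ½ * p ≡ p
  half p = trans (sym (*-distribʳ-+ p ½ ½)) (*-identityˡ p)

  0<½* : ∀ {p} → 0ℚ < p → 0ℚ < ½ * p
  0<½* = 0<* (positive⁻¹ ½)

  p≤∣p∣ : ∀ p → p ≤ ∣ p ∣
  p≤∣p∣ p with ≤-total 0ℚ p
  ... | inj₁ 0≤p = ≤-reflexive (sym (0≤p⇒∣p∣≡p 0≤p))
  ... | inj₂ p≤0 = ≤-trans p≤0 (0≤∣p∣ p)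

  ∣-∣-swap : ∀ p q → ∣ p - q ∣ ≡ ∣ q - p ∣
  ∣-∣-swap p q = trans (sym (∣-p∣≡∣p∣ (p - q)))
    (cong ∣_∣ (solve 2 (λ p q → :- (p :- q) := q :- p) refl p q))

  ∣-∣-elim : ∀ {p q ε} → ∣ p - q ∣ ≤ ε → p ≤ q + ε
  ∣-∣-elim {p} {q} {ε} h = begin
    p           ≡⟨ solve 2 (λ p q → p := q :+ (p :- q)) refl p q ⟩
    q + (p - q) ≤⟨ +-monoʳ-≤ q (≤-trans (p≤∣p∣ _) h) ⟩
    q + ε       ∎

  ∣-∣-intro : ∀ {p q ε} → p ≤ q + ε → q ≤ p + ε → ∣ p - q ∣ ≤ ε
  ∣-∣-intro {p} {q} {ε} a b with ∣p∣≡p∨∣p∣≡-p (p - q)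
  ... | inj₁ e = begin
    ∣ p - q ∣ ≡⟨ e ⟩
    p - q     ≤⟨ +-monoˡ-≤ (- q) a ⟩
    q + ε - q ≡⟨ solve 2 (λ q ε → q :+ ε :- q := ε) refl q ε ⟩
    ε         ∎
  ... | inj₂ e = begin
    ∣ p - q ∣ ≡⟨ e ⟩
    - (p - q) ≡⟨ solve 2 (λ p q → :- (p :- q) := q :- p) refl p q ⟩
    q - p     ≤⟨ +-monoˡ-≤ (- p) b ⟩
    p + ε - p ≡⟨ solve 2 (λ q ε → q :+ ε :- q := ε) refl p ε ⟩
    ε         ∎

  sq-mono : ∀ {p q} → 0ℚ ≤ p → p ≤ q → p * p ≤ q * q
  sq-mono h le = *-mono h (≤-trans h le) le le

  sq-cancel-< : ∀ {p q} → 0ℚ ≤ q → p * p < q * q → p < q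
  sq-cancel-< h lt = ≰⇒> λ le → <-irrefl refl (<-≤-trans lt (sq-mono h le))

  *-cancel-inv : ∀ {p} q → 0ℚ < p → p * (q * inv p) ≡ q
  *-cancel-inv {p} q h = begin-equality
    p * (q * inv p) ≡⟨ solve 3 (λ p q i → p :* (q :* i) := q :* (p :* i)) refl p q (inv p) ⟩
    q * (p * inv p) ≡⟨ cong (q *_) (*-inv h) ⟩
    q * 1ℚ          ≡⟨ *-identityʳ q ⟩
    q               ∎

  *-close : ∀ {B C δ} a b c d → 0ℚ ≤ B → 0ℚ ≤ C → ∣ a ∣ ≤ B → ∣ d ∣ ≤ C →
            ∣ a - c ∣ ≤ δ → ∣ b - d ∣ ≤ δ → ∣ a * b - c * d ∣ ≤ (B + C) * δ
  *-close {B} {C} {δ} a b c d 0≤B 0≤C a≤B d≤C a-c b-d = begin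
    ∣ a * b - c * d ∣
      ≡⟨ cong ∣_∣ (solve 4 (λ a b c d → a :* b :- c :* d := a :* (b :- d) :+ d :* (a :- c))
                   refl a b c d) ⟩
    ∣ a * (b - d) + d * (a - c) ∣
      ≤⟨ ∣p+q∣≤∣p∣+∣q∣ (a * (b - d)) (d * (a - c)) ⟩
    ∣ a * (b - d) ∣ + ∣ d * (a - c) ∣
      ≡⟨ cong₂ _+_ (∣p*q∣≡∣p∣*∣q∣ a (b - d)) (∣p*q∣≡∣p∣*∣q∣ d (a - c)) ⟩
    ∣ a ∣ * ∣ b - d ∣ + ∣ d ∣ * ∣ a - c ∣
      ≤⟨ +-mono-≤ (*-mono {∣ a ∣} {B} {∣ b - d ∣} {δ} (0≤∣p∣ (b - d)) 0≤B a≤B b-d)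
                  (*-mono {∣ d ∣} {C} {∣ a - c ∣} {δ} (0≤∣p∣ (a - c)) 0≤C d≤C a-c) ⟩
    B * δ + C * δ
      ≡⟨ sym (*-distribʳ-+ δ B C) ⟩
    (B + C) * δ ∎

  inv-close : ∀ {η ε} a b → 0ℚ < η → 0ℚ ≤ ε → η ≤ a → η ≤ b →
              ∣ b - a ∣ ≤ ε * (η * η) → ∣ inv a - inv b ∣ ≤ ε
  inv-close {η} {ε} a b 0<η 0≤ε η≤a η≤b close =
    *-cancelʳ-≤-pos (a * b) {{positive 0<ab}} (begin
    ∣ inv a - inv b ∣ * (a * b)
      ≡⟨ cong (∣ inv a - inv b ∣ *_) (sym (0≤p⇒∣p∣≡p (<⇒≤ 0<ab))) ⟩
    ∣ inv a - inv b ∣ * ∣ a * b ∣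
      ≡⟨ sym (∣p*q∣≡∣p∣*∣q∣ (inv a - inv b) (a * b)) ⟩
    ∣ (inv a - inv b) * (a * b) ∣
      ≡⟨ cong ∣_∣ (solve 4 (λ a b i j → (i :- j) :* (a :* b) := b :* (a :* i) :- a :* (b :* j))
                   refl a b (inv a) (inv b)) ⟩
    ∣ b * (a * inv a) - a * (b * inv b) ∣
      ≡⟨ cong ∣_∣ (cong₂ (λ u v → b * u - a * v) (*-inv 0<a) (*-inv 0<b)) ⟩
    ∣ b * 1ℚ - a * 1ℚ ∣
      ≡⟨ cong ∣_∣ (cong₂ _-_ (*-identityʳ b) (*-identityʳ a)) ⟩
    ∣ b - a ∣
      ≤⟨ close ⟩
    ε * (η * η)
      ≤⟨ *-monoˡ {ε} {η * η} {a * b} 0≤ε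
           (*-mono {η} {a} {η} {b} (<⇒≤ 0<η) (<⇒≤ 0<a) η≤a η≤b) ⟩
    ε * (a * b) ∎)
    where
    0<a = <-≤-trans 0<η η≤a
    0<b = <-≤-trans 0<η η≤b
    0<ab : 0ℚ < a * b
    0<ab = 0<* 0<a 0<b

  if-elim : ∀ {A : Set} {p q} (P : ℚ → Set) (d : Dec A) →
            (A → P p) → (¬ A → P q) → P (if does d then p else q)
  if-elim P (yes a) f g = f a
  if-elim P (no ¬a) f g = g ¬a

open ℚ-Lemmas

record ℝ : Set where
  constructor mkℝ
  field
    seq    : ℕ → ℚ
    cauchy : ∀ ε → 0ℚ < ε → ∃ λ K → ∀ m n → K ℕ.≤ m → K ℕ.≤ n →
             ∣ seq m - seq n ∣ ≤ ε

open ℝ public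

infix 4 _≃ᵣ_ _≤ᵣ_ _<ᵣ_

_≤ᵣ_ : ℝ → ℝ → Set
x ≤ᵣ y = ∀ ε → 0ℚ < ε → ∃ λ K → ∀ n → K ℕ.≤ n → seq x n ≤ seq y n + ε

_<ᵣ_ : ℝ → ℝ → Set
x <ᵣ y = ∃ λ ε → 0ℚ < ε × ∃ λ K → ∀ n → K ℕ.≤ n → seq x n + ε ≤ seq y n

_≃ᵣ_ : ℝ → ℝ → Set
x ≃ᵣ y = x ≤ᵣ y × y ≤ᵣ x

fromℚ : ℚ → ℝ
fromℚ p .seq    _   = p
fromℚ p .cauchy ε h = 0 , λ _ _ _ _ →
  ≤-trans (≤-reflexive (cong ∣_∣ (+-inverseʳ p))) (<⇒≤ h)

infixl 6 _+ᵣ_ _-ᵣ_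
infixl 7 _*ᵣ_ _÷ᵣ_[_]
infix  8 -ᵣ_

_+ᵣ_ : ℝ → ℝ → ℝ
(x +ᵣ y) .seq n = seq x n + seq y n
(x +ᵣ y) .cauchy ε h
  with cauchy x (½ * ε) (0<½* h) | cauchy y (½ * ε) (0<½* h)
... | K , f | L , g = K ℕ.⊔ L , λ m n p q → begin
  ∣ (seq x m + seq y m) - (seq x n + seq y n) ∣
    ≡⟨ cong ∣_∣ (solve 4 (λ a b c d → (a :+ b) :- (c :+ d) := (a :- c) :+ (b :- d))
                 refl (seq x m) (seq y m) (seq x n) (seq y n)) ⟩
  ∣ (seq x m - seq x n) + (seq y m - seq y n) ∣
    ≤⟨ ∣p+q∣≤∣p∣+∣q∣ (seq x m - seq x n) (seq y m - seq y n) ⟩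
  ∣ seq x m - seq x n ∣ + ∣ seq y m - seq y n ∣
    ≤⟨ +-mono-≤ (f m n (ℕ.m⊔n≤o⇒m≤o K L p) (ℕ.m⊔n≤o⇒m≤o K L q))
                (g m n (ℕ.m⊔n≤o⇒n≤o K L p) (ℕ.m⊔n≤o⇒n≤o K L q)) ⟩
  ½ * ε + ½ * ε ≡⟨ half ε ⟩
  ε ∎
  where open ≤-Reasoning

-ᵣ_ : ℝ → ℝ
(-ᵣ x) .seq n = - seq x n
(-ᵣ x) .cauchy ε h with cauchy x ε h
... | K , f = K , λ m n p q → ≤-trans (≤-reflexive (trans
  (cong ∣_∣ (sym (neg-distrib-+ (seq x m) (- seq x n)))) (∣-p∣≡∣p∣ _))) (f m n p q)

_-ᵣ_ : ℝ → ℝ → ℝ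
x -ᵣ y = x +ᵣ (-ᵣ y)

eventually-bounded : ∀ x → ∃ λ B → 0ℚ < B × ∃ λ K → ∀ n → K ℕ.≤ n → ∣ seq x n ∣ ≤ B
eventually-bounded x with cauchy x 1ℚ (positive⁻¹ 1ℚ)
... | K , f = ∣ seq x K ∣ + 1ℚ , +-mono-≤-< (0≤∣p∣ (seq x K)) (positive⁻¹ 1ℚ) , K , λ n p → begin
  ∣ seq x n ∣
    ≡⟨ cong ∣_∣ (solve 2 (λ p q → p := q :+ (p :- q)) refl (seq x n) (seq x K)) ⟩
  ∣ seq x K + (seq x n - seq x K) ∣
    ≤⟨ ∣p+q∣≤∣p∣+∣q∣ (seq x K) (seq x n - seq x K) ⟩
  ∣ seq x K ∣ + ∣ seq x n - seq x K ∣
    ≤⟨ +-monoʳ-≤ ∣ seq x K ∣ (f n K p ℕ.≤-refl) ⟩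
  ∣ seq x K ∣ + 1ℚ ∎
  where open ≤-Reasoning

_*ᵣ_ : ℝ → ℝ → ℝ
(x *ᵣ y) .seq n = seq x n * seq y n
(x *ᵣ y) .cauchy ε h = (Kx ℕ.⊔ Ky) ℕ.⊔ (K ℕ.⊔ L) , close
  where
  bx  = eventually-bounded x
  by  = eventually-bounded y
  B   = proj₁ bx
  C   = proj₁ by
  0<B = proj₁ (proj₂ bx)
  0<C = proj₁ (proj₂ by)
  Kx  = proj₁ (proj₂ (proj₂ bx))
  Ky  = proj₁ (proj₂ (proj₂ by))
  δ   = ε * inv (B + C)
  0<B+C : 0ℚ < B + C
  0<B+C = 0<+ 0<B 0<C
  0<δ : 0ℚ < δ
  0<δ = 0<* h (0<inv 0<B+C)
  cx  = cauchy x δ 0<δ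
  cy  = cauchy y δ 0<δ
  K   = proj₁ cx
  L   = proj₁ cy
  close : ∀ m n → (Kx ℕ.⊔ Ky) ℕ.⊔ (K ℕ.⊔ L) ℕ.≤ m → (Kx ℕ.⊔ Ky) ℕ.⊔ (K ℕ.⊔ L) ℕ.≤ n →
          ∣ seq x m * seq y m - seq x n * seq y n ∣ ≤ ε
  close m n p q = ≤-trans
    (*-close (seq x m) (seq y m) (seq x n) (seq y n) (<⇒≤ 0<B) (<⇒≤ 0<C)
      (proj₂ (proj₂ (proj₂ bx)) m (ℕ.m⊔n≤o⇒m≤o Kx Ky p₁))
      (proj₂ (proj₂ (proj₂ by)) n (ℕ.m⊔n≤o⇒n≤o Kx Ky q₁))
      (proj₂ cx m n (ℕ.m⊔n≤o⇒m≤o K L p₂) (ℕ.m⊔n≤o⇒m≤o K L q₂))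
      (proj₂ cy m n (ℕ.m⊔n≤o⇒n≤o K L p₂) (ℕ.m⊔n≤o⇒n≤o K L q₂)))
    (≤-reflexive (*-cancel-inv ε 0<B+C))
    where
    p₁ = ℕ.m⊔n≤o⇒m≤o (Kx ℕ.⊔ Ky) (K ℕ.⊔ L) p
    p₂ = ℕ.m⊔n≤o⇒n≤o (Kx ℕ.⊔ Ky) (K ℕ.⊔ L) p
    q₁ = ℕ.m⊔n≤o⇒m≤o (Kx ℕ.⊔ Ky) (K ℕ.⊔ L) q
    q₂ = ℕ.m⊔n≤o⇒n≤o (Kx ℕ.⊔ Ky) (K ℕ.⊔ L) q

-- The finitely many terms that may vanish are inverted to 0; the positivity
-- proof only enters the Cauchy condition, not the sequence.
recip : ∀ x → fromℚ 0ℚ <ᵣ x → ℝ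
recip x _ .seq n = inv (seq x n)
recip x (η , 0<η , K , lb) .cauchy ε h
  with cauchy x (ε * (η * η)) (0<* h (0<* 0<η 0<η))
... | L , f = K ℕ.⊔ L , λ m n p q → inv-close (seq x m) (seq x n) 0<η (<⇒≤ h)
  (≤-trans (≤-reflexive (sym (+-identityˡ η))) (lb m (ℕ.m⊔n≤o⇒m≤o K L p)))
  (≤-trans (≤-reflexive (sym (+-identityˡ η))) (lb n (ℕ.m⊔n≤o⇒m≤o K L q)))
  (f n m (ℕ.m⊔n≤o⇒n≤o K L q) (ℕ.m⊔n≤o⇒n≤o K L p))

_÷ᵣ_[_] : (x y : ℝ) → fromℚ 0ℚ <ᵣ y → ℝ
x ÷ᵣ y [ 0<y ] = x *ᵣ recip y 0<y

-- Square roots of rationals, by bisection: at every step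
-- lower² ≤ q < (lower + gap)².  A negative radicand is replaced by 0.

module Bisection (q : ℚ) where

  gap : ℕ → ℚ
  gap zero    = 1ℚ + q
  gap (suc n) = ½ * gap n

  lower : ℕ → ℚ
  lower zero    = 0ℚ
  lower (suc n) = if does (mid * mid ≤? q) then mid else lower n
    where mid = lower n + gap (suc n)

  mid : ℕ → ℚ
  mid n = lower n + gap (suc n)

  module _ (0≤q : 0ℚ ≤ q) where
    open ≤-Reasoning

    0≤gap : ∀ n → 0ℚ ≤ gap n
    0≤gap zero    = 0≤+ {1ℚ} {q} (nonNegative⁻¹ 1ℚ) 0≤q
    0≤gap (suc n) = 0≤* {½} {gap n} (nonNegative⁻¹ ½) (0≤gap n)

    0≤lower : ∀ n → 0ℚ ≤ lower n
    0≤lower zero = ≤-refl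
    0≤lower (suc n) = if-elim (0ℚ ≤_) (mid n * mid n ≤? q)
      (λ _ → 0≤+ {lower n} {gap (suc n)} (0≤lower n) (0≤gap (suc n)))
      (λ _ → 0≤lower n)

    0≤upper : ∀ n → 0ℚ ≤ lower n + gap n
    0≤upper n = 0≤+ {lower n} {gap n} (0≤lower n) (0≤gap n)

    lower²≤q : ∀ n → lower n * lower n ≤ q
    lower²≤q zero = 0≤q
    lower²≤q (suc n) = if-elim (λ l → l * l ≤ q) (mid n * mid n ≤? q)
      (λ mid²≤q → mid²≤q)
      (λ _ → lower²≤q n)

    q<upper² : ∀ n → q < (lower n + gap n) * (lower n + gap n)
    q<upper² zero = begin-strict
      q                            ≡⟨ sym (+-identityˡ q) ⟩
      0ℚ + q                       <⟨ +-monoˡ-< q (positive⁻¹ 1ℚ) ⟩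
      1ℚ + q                       ≤⟨ p≤p+q {1ℚ + q} {q * (1ℚ + q)} (0≤* {q} {1ℚ + q} 0≤q (0≤gap 0)) ⟩
      (1ℚ + q) + q * (1ℚ + q)      ≡⟨ solve 1 (λ q → (con 1ℚ :+ q) :+ q :* (con 1ℚ :+ q)
                                        := (con 0ℚ :+ (con 1ℚ :+ q)) :* (con 0ℚ :+ (con 1ℚ :+ q))) refl q ⟩
      (0ℚ + (1ℚ + q)) * (0ℚ + (1ℚ + q)) ∎
    q<upper² (suc n) = if-elim (λ l → q < (l + gap (suc n)) * (l + gap (suc n)))
      (mid n * mid n ≤? q)
      (λ _ → subst (λ u → q < u * u)
        (trans (cong (λ g → lower n + g) (sym (half (gap n))))
               (sym (+-assoc (lower n) (½ * gap n) (½ * gap n))))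
        (q<upper² n))
      ≰⇒>

    lower≤upper : ∀ m n → lower m ≤ lower n + gap n
    lower≤upper m n = <⇒≤ (sq-cancel-< {lower m} {lower n + gap n} (0≤upper n)
      (≤-<-trans (lower²≤q m) (q<upper² n)))

    gap-antitone : ∀ {m n} → m ℕ.≤ n → gap n ≤ gap m
    gap-antitone m≤n = go (ℕ.≤⇒≤′ m≤n)
      where
      go : ∀ {m n} → m ℕ.≤′ n → gap n ≤ gap m
      go ℕ.≤′-refl = ≤-refl
      go {m} {suc n} (ℕ.≤′-step p) = begin
        ½ * gap n              ≤⟨ p≤p+q {½ * gap n} {½ * gap n} (0≤gap (suc n)) ⟩
        ½ * gap n + ½ * gap n  ≡⟨ half (gap n) ⟩
        gap n                  ≤⟨ go p ⟩
        gap m                  ∎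

    gap*suc : ∀ n → gap n * fromℕ (suc n) ≤ 1ℚ + q
    gap*suc zero    = ≤-reflexive (*-identityʳ _)
    gap*suc (suc n) = begin
      ½ * gap n * fromℕ (2 ℕ.+ n)
        ≡⟨ cong (½ * gap n *_) (fromℕ-suc (suc n)) ⟩
      ½ * gap n * (1ℚ + fromℕ (suc n))
        ≤⟨ *-monoˡ {½ * gap n} {1ℚ + fromℕ (suc n)} {fromℕ (suc n) + fromℕ (suc n)} (0≤gap (suc n)) (+-monoˡ-≤ (fromℕ (suc n)) {1ℚ} {fromℕ (suc n)} (fromℕ-mono {1} {suc n} (ℕ.s≤s ℕ.z≤n))) ⟩
      ½ * gap n * (fromℕ (suc n) + fromℕ (suc n))
        ≡⟨ solve 3 (λ h g k → h :* g :* (k :+ k) := h :* (g :* k) :+ h :* (g :* k))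
             refl ½ (gap n) (fromℕ (suc n)) ⟩
      ½ * (gap n * fromℕ (suc n)) + ½ * (gap n * fromℕ (suc n))
        ≡⟨ half _ ⟩
      gap n * fromℕ (suc n)
        ≤⟨ gap*suc n ⟩
      1ℚ + q ∎

    gap-small : ∀ ε → 0ℚ < ε → ∃ λ K → ∀ n → K ℕ.≤ n → gap n ≤ ε
    gap-small ε h with archimedean ((1ℚ + q) * inv ε)
    ... | K , p = K , λ n K≤n → *-cancelʳ-≤-pos (fromℕ (suc n)) (begin
      gap n * fromℕ (suc n)        ≤⟨ gap*suc n ⟩
      1ℚ + q                       ≡⟨ sym (*-identityʳ _) ⟩
      (1ℚ + q) * 1ℚ                ≡⟨ cong ((1ℚ + q) *_) (sym (*-inv h)) ⟩
      (1ℚ + q) * (ε * inv ε)       ≡⟨ solve 3 (λ a e i → a :* (e :* i) := e :* (a :* i)) refl (1ℚ + q) ε (inv ε) ⟩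
      ε * ((1ℚ + q) * inv ε)       ≤⟨ *-monoˡ {ε} {(1ℚ + q) * inv ε} {fromℕ (suc n)} (<⇒≤ h) (≤-trans p (fromℕ-mono (ℕ.≤-trans K≤n (ℕ.n≤1+n n)))) ⟩
      ε * fromℕ (suc n)            ∎)

    lower-cauchy : ∀ ε → 0ℚ < ε → ∃ λ K → ∀ m n → K ℕ.≤ m → K ℕ.≤ n →
                   ∣ lower m - lower n ∣ ≤ ε
    lower-cauchy ε h = proj₁ small , λ m n p q →
      ∣-∣-intro {lower m} {lower n} {ε} (close m n q) (close n m p)
      where
      small = gap-small ε h
      close : ∀ m n → proj₁ small ℕ.≤ n → lower m ≤ lower n + ε
      close m n p = ≤-trans (lower≤upper m n)
        (+-monoʳ-≤ (lower n) {gap n} {ε} (proj₂ small n p))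

    lower-≥ : ∀ {c} → c * c ≤ q → ∀ ε → 0ℚ < ε →
              ∃ λ K → ∀ n → K ℕ.≤ n → c ≤ lower n + ε
    lower-≥ {c} c²≤q ε h = proj₁ small , λ n p → ≤-trans
      (<⇒≤ (sq-cancel-< {c} {lower n + gap n} (0≤upper n) (≤-<-trans c²≤q (q<upper² n))))
      (+-monoʳ-≤ (lower n) {gap n} {ε} (proj₂ small n p))
      where small = gap-small ε h

    q≤lower²+ : ∀ n → q ≤ lower n * lower n + gap n * ((1ℚ + q) + (1ℚ + q) + (1ℚ + q))
    q≤lower²+ n = begin
      q                          ≤⟨ <⇒≤ (q<upper² n) ⟩
      (l + g) * (l + g)          ≡⟨ solve 2 (λ l g → (l :+ g) :* (l :+ g) := l :* l :+ g :* (l :+ l :+ g)) refl l g ⟩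
      l * l + g * (l + l + g)    ≤⟨ +-monoʳ-≤ (l * l) (*-monoˡ {g} {l + l + g} {u + u + u} (0≤gap n) sum≤) ⟩
      l * l + g * (u + u + u)    ∎
      where
      l = lower n
      g = gap n
      u = 1ℚ + q
      l≤u : l ≤ u
      l≤u = ≤-trans (lower≤upper n 0) (≤-reflexive (+-identityˡ u))
      sum≤ : l + l + g ≤ u + u + u
      sum≤ = +-mono-≤ {l + l} {u + u} {g} {u} (+-mono-≤ {l} {u} {l} {u} l≤u l≤u)
               (gap-antitone {0} {n} ℕ.z≤n)

√_ : ℚ → ℝ
(√ q) .seq    = Bisection.lower (0ℚ ⊔ q)
(√ q) .cauchy = Bisection.lower-cauchy (0ℚ ⊔ q) (p≤p⊔q 0ℚ q)

√-nonneg : ∀ q → fromℚ 0ℚ ≤ᵣ √ q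
√-nonneg q ε h = 0 , λ n _ →
  0≤+ {Bisection.lower (0ℚ ⊔ q) n} {ε} (Bisection.0≤lower (0ℚ ⊔ q) (p≤p⊔q 0ℚ q) n) (<⇒≤ h)

√-square : ∀ q → 0ℚ ≤ q → √ q *ᵣ √ q ≃ᵣ fromℚ q
√-square q 0≤q = subst (λ p → √ q *ᵣ √ q ≃ᵣ fromℚ p) (p≤q⇒p⊔q≡q 0≤q) (≤q , q≤)
  where
  q⁺ = 0ℚ ⊔ q
  0≤q⁺ : 0ℚ ≤ q⁺
  0≤q⁺ = p≤p⊔q 0ℚ q
  open Bisection q⁺
  D : ℚ
  D = (1ℚ + q⁺) + (1ℚ + q⁺) + (1ℚ + q⁺)
  0<1+q⁺ : 0ℚ < 1ℚ + q⁺
  0<1+q⁺ = +-mono-<-≤ {0ℚ} {1ℚ} {0ℚ} {q⁺} (positive⁻¹ 1ℚ) 0≤q⁺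
  0<D : 0ℚ < D
  0<D = 0<+ {(1ℚ + q⁺) + (1ℚ + q⁺)} {1ℚ + q⁺} (0<+ {1ℚ + q⁺} {1ℚ + q⁺} 0<1+q⁺ 0<1+q⁺) 0<1+q⁺
  ≤q : √ q *ᵣ √ q ≤ᵣ fromℚ q⁺
  ≤q ε h = 0 , λ n _ → ≤-trans (lower²≤q 0≤q⁺ n) (p≤p+q {q⁺} {ε} (<⇒≤ h))
  q≤ : fromℚ q⁺ ≤ᵣ √ q *ᵣ √ q
  q≤ ε h = proj₁ small , λ n p → ≤-trans (q≤lower²+ 0≤q⁺ n)
    (+-monoʳ-≤ (lower n * lower n) {gap n * D} {ε}
      (≤-trans (*-monoʳ {D} {gap n} {ε * inv D} (<⇒≤ 0<D) (proj₂ small n p))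
        (≤-reflexive (trans (*-comm (ε * inv D) D) (*-cancel-inv ε 0<D)))))
    where small = gap-small 0≤q⁺ (ε * inv D) (0<* {ε} {inv D} h (0<inv 0<D))

√-≥ : ∀ q {c} → c * c ≤ q → ∀ ε → 0ℚ < ε →
      ∃ λ K → ∀ n → K ℕ.≤ n → c ≤ seq (√ q) n + ε
√-≥ q {c} c²≤q = Bisection.lower-≥ (0ℚ ⊔ q) (p≤p⊔q 0ℚ q) {c} (≤-trans c²≤q (p≤q⊔p 0ℚ q))

√-< : ∀ q {c} → 0ℚ ≤ c → 0ℚ < c * c → q < c * c → ∀ n → seq (√ q) n < c
√-< q {c} 0≤c 0<c² q<c² n = sq-cancel-< {seq (√ q) n} {c} 0≤c
  (≤-<-trans (Bisection.lower²≤q (0ℚ ⊔ q) (p≤p⊔q 0ℚ q) n) 0⊔q<c²)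
  where
  0⊔q<c² : 0ℚ ⊔ q < c * c
  0⊔q<c² with ⊔-sel 0ℚ q
  ... | inj₁ e = subst (_< c * c) (sym e) 0<c²
  ... | inj₂ e = subst (_< c * c) (sym e) q<c²

√-seq-nonneg : ∀ q n → 0ℚ ≤ seq (√ q) n
√-seq-nonneg q = Bisection.0≤lower (0ℚ ⊔ q) (p≤p⊔q 0ℚ q)

record SimpleGraph (N : ℕ) : Set₁ where
  infix 4 _~_ _~?_
  field
    _~_      : Rel (Fin N) 0ℓ
    _~?_     : Decidable _~_
    ~-sym    : Symmetric _~_
    ~-irrefl : ∀ {i} → ¬ (i ~ i)

Connected : ∀ {N} → SimpleGraph N → Set
Connected G = ∀ i j → Star _~_ i j
  where open SimpleGraph G

Matrix : ℕ → Set
Matrix N = Fin N → Fin N → ℚ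

_·_ : ∀ {N} → Matrix N → Matrix N → Matrix N
_·_ {N} A B i k = ∑[ j < N ] (A i j * B j k)

tr : ∀ {N} → Matrix N → ℚ
tr {N} A = ∑[ i < N ] A i i

∑-pairs : ∀ {N} → (Fin N → Fin N → ℚ) → ℚ
∑-pairs {N} f = ∑[ i < N ] (∑[ j < N ] (if does (i Fin.<? j) then f i j else 0ℚ))

module _ {N : ℕ} (G : SimpleGraph N) where
  open SimpleGraph G

  degree : Fin N → ℕ
  degree i = ℕΣ.sum (λ j → if does (i ~? j) then 1 else 0)

  d : Fin N → ℚ
  d i = fromℕ (degree i)

  P : Matrix N
  P v w = if does (v ~? w) then inv (d v) else 0ℚ

  ∑-edges : (Fin N → Fin N → ℚ) → ℚ
  ∑-edges f = ∑-pairs (λ i j → if does (i ~? j) then f i j else 0ℚ)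

  σ² : ℚ
  σ² = fromℕ 2 * inv (fromℕ N) * ∑-edges (λ i j → inv (d i * d j))

  σ : ℝ
  σ = √ σ²

  δ : Fin N → Fin N → ℚ
  δ i k = if does (i Fin.≟ k) then 1ℚ else 0ℚ

  -- v drives a unit current in at i and out at j: v k - v l is the current from
  -- k to l through a unit resistor, and Kirchhoff's current law holds at every k.
  UnitCurrentPotential : Fin N → Fin N → (Fin N → ℚ) → Set
  UnitCurrentPotential i j v = ∀ k →
    ∑[ l < N ] (if does (k ~? l) then v k - v l else 0ℚ) ≡ δ i k - δ j k

  -- Kirchhoff's equations have integer coefficients and, for connected graphs,
  -- a solution unique up to an additive constant, so rational potentials suffice.
  IsEffectiveResistance : Fin N → Fin N → ℚ → Set
  IsEffectiveResistance i j r = ∃ λ v → UnitCurrentPotential i j v × r ≡ v i - v j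

  R⁺ : Matrix N → ℚ
  R⁺ R = ∑-pairs (λ i j → (d i + d j) * R i j)


sum-mono : ∀ {n} {f g : Fin n → ℚ} → (∀ i → f i ≤ g i) → sum f ≤ sum g
sum-mono {zero}          h = ≤-refl
sum-mono {suc n} {f} {g} h = +-mono-≤ {f Fin.zero} {g Fin.zero} (h Fin.zero)
  (sum-mono {n} (λ i → h (Fin.suc i)))

sum-one : ∀ n → sum {n} (λ _ → 1ℚ) ≡ fromℕ n
sum-one zero    = refl
sum-one (suc n) = trans (cong (λ s → 1ℚ + s) (sum-one n)) (sym (fromℕ-suc n))

sum-indicator : ∀ {n} (b : Fin n → Bool) c →
  sum (λ j → if b j then c else 0ℚ) ≡ fromℕ (ℕΣ.sum (λ j → if b j then 1 else 0)) * c
sum-indicator {zero} b c = sym (*-zeroˡ c)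
sum-indicator {suc n} b c with b Fin.zero | sum-indicator (λ j → b (Fin.suc j)) c
... | false | ih = trans (+-identityˡ _) ih
... | true  | ih = trans (cong (λ s → c + s) ih) (trans
  (solve 2 (λ c k → c :+ k :* c := (con 1ℚ :+ k) :* c) refl c (fromℕ k))
  (cong (_* c) (sym (fromℕ-suc k))))
  where k = ℕΣ.sum (λ j → if b (Fin.suc j) then 1 else 0)

inv-* : ∀ m n → inv (fromℕ m * fromℕ n) ≤ inv (fromℕ m)
inv-* zero    n       = ≤-reflexive (cong inv (*-zeroˡ (fromℕ n)))
inv-* (suc m) zero    = ≤-trans (≤-reflexive (cong inv (*-zeroʳ (fromℕ (suc m)))))
  (0≤inv (0≤fromℕ (suc m)))
inv-* (suc m) (suc n) = inv≤ {a * b} {inv a} (0<* {a} {b} (positive⁻¹ a) (positive⁻¹ b)) (begin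
  1ℚ              ≤⟨ fromℕ-mono {1} {suc n} (ℕ.s≤s ℕ.z≤n) ⟩
  b               ≡⟨ sym (*-identityʳ b) ⟩
  b * 1ℚ          ≡⟨ cong (b *_) (sym (*-inv {a} (positive⁻¹ a))) ⟩
  b * (a * inv a) ≡⟨ solve 3 (λ a b i → b :* (a :* i) := a :* b :* i) refl a b (inv a) ⟩
  a * b * inv a   ∎)
  where
  open ≤-Reasoning
  a = fromℕ (suc m)
  b = fromℕ (suc n)

σ²≤2 : ∀ {N} (G : SimpleGraph N) → σ² G ≤ fromℕ 2
σ²≤2 {N} G = begin
  fromℕ 2 * inv (fromℕ N) * S ≤⟨ *-monoˡ {fromℕ 2 * inv (fromℕ N)} {S} {fromℕ N} 0≤2/N S≤N ⟩
  fromℕ 2 * inv (fromℕ N) * fromℕ N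
    ≡⟨ solve 3 (λ t i n → t :* i :* n := t :* (n :* i)) refl (fromℕ 2) (inv (fromℕ N)) (fromℕ N) ⟩
  fromℕ 2 * (fromℕ N * inv (fromℕ N))
    ≤⟨ *-monoˡ {fromℕ 2} {fromℕ N * inv (fromℕ N)} {1ℚ} (0≤fromℕ 2) (*-inv≤1 (fromℕ N)) ⟩
  fromℕ 2 * 1ℚ ≡⟨⟩
  fromℕ 2 ∎
  where
  open ≤-Reasoning
  open SimpleGraph G
  S : ℚ
  S = ∑-edges G (λ i j → inv (d G i * d G j))
  0≤2/N : 0ℚ ≤ fromℕ 2 * inv (fromℕ N)
  0≤2/N = 0≤* {fromℕ 2} {inv (fromℕ N)} (0≤fromℕ 2) (0≤inv (0≤fromℕ N))
  term≤ : ∀ (b c : Bool) i j → (if b then (if c then inv (d G i * d G j) else 0ℚ) else 0ℚ)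
          ≤ (if c then inv (d G i) else 0ℚ)
  term≤ true  true  i j = inv-* (degree G i) (degree G j)
  term≤ true  false i j = ≤-refl
  term≤ false true  i j = 0≤inv (0≤fromℕ (degree G i))
  term≤ false false i j = ≤-refl
  row≤ : ∀ i → (∑[ j < N ] (if does (i ~? j) then inv (d G i) else 0ℚ)) ≤ 1ℚ
  row≤ i = ≤-trans (≤-reflexive (sum-indicator (λ j → does (i ~? j)) (inv (d G i))))
    (*-inv≤1 (d G i))
  S≤N : S ≤ fromℕ N
  S≤N = ≤-trans
    (sum-mono λ i → ≤-trans
      (sum-mono λ j → term≤ (does (i Fin.<? j)) (does (i ~? j)) i j) (row≤ i))
    (≤-reflexive (sum-one N))

module _ {N : ℕ} (2≤N : 2 ℕ.≤ N) where

  √[N-1] : ℝ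
  √[N-1] = √ (fromℕ (N ∸ 1))

  √[N-1]-positive : fromℚ 0ℚ <ᵣ √[N-1]
  √[N-1]-positive = ½ , positive⁻¹ ½ , proj₁ near , λ n p →
    ≤-trans (≤-reflexive (+-identityˡ ½))
    (≤-trans (+-monoˡ-≤ (- ½) (proj₂ near n p)) (≤-reflexive
      (solve 2 (λ l h → l :+ h :- h := l) refl (seq √[N-1] n) ½)))
    where
    near = √-≥ (fromℕ (N ∸ 1)) {1ℚ} (fromℕ-mono {1} {N ∸ 1} (ℕ.∸-monoˡ-≤ 1 2≤N)) ½ (positive⁻¹ ½)

  module _ (G : SimpleGraph N) where

    σ/√[N-1] : ℝ
    σ/√[N-1] = σ G ÷ᵣ √[N-1] [ √[N-1]-positive ]

    σ/√[N-1]-seq-nonneg : ∀ n → 0ℚ ≤ seq σ/√[N-1] n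
    σ/√[N-1]-seq-nonneg n = 0≤* {seq (σ G) n} {inv (seq √[N-1] n)}
      (√-seq-nonneg (σ² G) n) (0≤inv (√-seq-nonneg (fromℕ (N ∸ 1)) n))

    1+σ/√[N-1]-positive : fromℚ 0ℚ <ᵣ fromℚ 1ℚ +ᵣ σ/√[N-1]
    1+σ/√[N-1]-positive = 1ℚ , positive⁻¹ 1ℚ , 0 , λ n _ →
      ≤-trans (≤-reflexive (+-identityˡ 1ℚ))
        (p≤p+q {1ℚ} {seq σ/√[N-1] n} (σ/√[N-1]-seq-nonneg n))

    N-1-σ/√[N-1]-positive : 3 ℕ.≤ N → fromℚ 0ℚ <ᵣ fromℚ (fromℕ (N ∸ 1)) -ᵣ σ/√[N-1]
    N-1-σ/√[N-1]-positive 3≤N = ½ , positive⁻¹ ½ , proj₁ near , λ n p → begin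
      0ℚ + ½                             ≡⟨⟩
      fromℕ 2 + - 3/2                    ≤⟨ +-mono-≤ {fromℕ 2} {fromℕ (N ∸ 1)} {(- 3/2)} {(- seq σ/√[N-1] n)}
                                              2≤N-1 (neg-antimono-≤ (ratio≤ n p)) ⟩
      fromℕ (N ∸ 1) + - seq σ/√[N-1] n   ∎
      where
      open ≤-Reasoning
      3/2 4/3 ⅓ : ℚ
      3/2 = (ℤ.+ 3) / 2
      4/3 = (ℤ.+ 4) / 3
      ⅓   = (ℤ.+ 1) / 3
      2≤N-1 : fromℕ 2 ≤ fromℕ (N ∸ 1)
      2≤N-1 = fromℕ-mono {2} {N ∸ 1} (ℕ.∸-monoˡ-≤ 1 3≤N)
      near = √-≥ (fromℕ (N ∸ 1)) {4/3}
        (≤-trans (≤ᵇ⇒≤ {4/3 * 4/3} {fromℕ 2} _) 2≤N-1) ⅓ (positive⁻¹ ⅓)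
      σ≤ : ∀ n → seq (σ G) n ≤ 3/2
      σ≤ n = <⇒≤ (√-< (σ² G) {3/2} (nonNegative⁻¹ 3/2) (positive⁻¹ (3/2 * 3/2))
        (≤-<-trans (σ²≤2 G) (toWitness {a? = fromℕ 2 <? 3/2 * 3/2} _)) n)
      1≤√ : ∀ n → proj₁ near ℕ.≤ n → 1ℚ ≤ seq √[N-1] n
      1≤√ n p = ≤-trans (+-monoˡ-≤ (- ⅓) {4/3} (proj₂ near n p)) (≤-reflexive
        (solve 2 (λ l h → l :+ h :- h := l) refl (seq √[N-1] n) ⅓))
      ratio≤ : ∀ n → proj₁ near ℕ.≤ n → seq σ/√[N-1] n ≤ 3/2
      ratio≤ n p = *-mono {seq (σ G) n} {3/2} {inv (seq √[N-1] n)} {1ℚ}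
        (0≤inv (√-seq-nonneg (fromℕ (N ∸ 1)) n)) (nonNegative⁻¹ 3/2) (σ≤ n)
        (inv≤ {seq √[N-1] n} {1ℚ} (<-≤-trans (positive⁻¹ 1ℚ) (1≤√ n p))
          (≤-trans (1≤√ n p) (≤-reflexive (sym (*-identityʳ _)))))

    -- For N = 2 this term has the form 0/0 (there σ = 1); as its numerator
    -- vanishes it is read as 0.
    [N-2]²/[N-1-σ/√[N-1]] : ℝ
    [N-2]²/[N-1-σ/√[N-1]] with 3 ℕ.≤? N
    ... | yes 3≤N = fromℚ (fromℕ (N ∸ 2) * fromℕ (N ∸ 2))
                    ÷ᵣ (fromℚ (fromℕ (N ∸ 1)) -ᵣ σ/√[N-1]) [ N-1-σ/√[N-1]-positive 3≤N ]
    ... | no  _   = fromℚ 0ℚ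

    lowerBound : ℝ
    lowerBound =
      fromℚ (fromℕ N) *ᵣ
        (fromℚ 1ℚ ÷ᵣ (fromℚ 1ℚ +ᵣ σ/√[N-1]) [ 1+σ/√[N-1]-positive ] +ᵣ [N-2]²/[N-1-σ/√[N-1]])
      +ᵣ fromℚ (fromℕ (N ∸ 1) * fromℕ (N ∸ 1))

{-# OPTIONS --safe #-}
module Submission where

open import Data.Bool using (true; false; if_then_else_)
open import Data.Empty using (⊥-elim)
open import Data.Fin using (Fin)
import Data.Fin as Fin
import Data.Fin.Properties as Fin
open import Data.Nat using (ℕ; zero; suc; _∸_)
import Data.Nat as ℕ
import Data.Nat.Properties as ℕ
open import Data.Product using (∃; _×_; _,_; proj₁; proj₂)
open import Data.Rational
open import Data.Rational.Properties
open import Data.Rational.Solver using (module +-*-Solver)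
open import Data.Sum using (inj₁; inj₂)
open import Relation.Binary using (tri<; tri≈; tri>)
import Relation.Binary.Construct.Closure.ReflexiveTransitive as Star
open import Relation.Binary.PropositionalEquality hiding ([_])
open import Relation.Nullary using (yes; no; does)
open import Relation.Nullary.Decidable using (dec-true; dec-false)
open import Algebra.Bundles using (CommutativeRing)
open import Algebra.Properties.Semiring.Sum (CommutativeRing.semiring +-*-commutativeRing) using (sum; sum-syntax; sum-cong-≗; ∑-distrib-+; ∑-comm; *-distribˡ-sum)
open import Defs
open +-*-Solver using (solve; _:+_; _:*_; :-_; _:-_; _:=_; con)
open ℚ-Lemmas

-- Write m = N - 1 and π = d / vol, and let W be the generalized inverse of the
-- Laplacian L with L (W j) = δ j - π and ⟨ π , W j ⟩ = 0.  Then
-- R i j = W i i + W j j - 2 W i j, hence R⁺ = N ∑ d j W j j + vol ∑ W j j.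
-- Dirichlet's principle gives m² as a lower bound for the second summand.  The
-- first is N ∑ 1 / y over the nonzero eigenvalues y of the normalized Laplacian.
-- As y ≤ 2, the cubic inequality (1 - b y)² (2 / y - 1) ≥ 0 bounds it by the
-- first two moments of y, for which traces suffice; b = m / N, the value of 1 / y
-- for the complete graph, yields N ∑ d j W j j ≥ m² + ½ m (m σ² - 1).  This
-- dominates N times the bracket of the theorem because 1 / m ≤ σ² ≤ 1.

-- Order and arithmetic of the rationals.

≤-from-gap : ∀ {p q} → 0ℚ ≤ q - p → p ≤ q
≤-from-gap {p} {q} h = ≤-trans (p≤p+q {p} h)
  (≤-reflexive (solve 2 (λ p q → p :+ (q :- p) := q) refl p q))

gap-nonneg : ∀ {p q} → p ≤ q → 0ℚ ≤ q - p
gap-nonneg {p} {q} h = ≤-trans (≤-reflexive (sym (+-inverseʳ p))) (+-monoˡ-≤ (- p) h)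

0≤square : ∀ p → 0ℚ ≤ p * p
0≤square p with ≤-total 0ℚ p
... | inj₁ 0≤p = 0≤* {p} {p} 0≤p 0≤p
... | inj₂ p≤0 = ≤-trans (0≤* { - p} { - p} 0≤-p 0≤-p)
  (≤-reflexive (solve 1 (λ p → (:- p) :* (:- p) := p :* p) refl p))
  where
  0≤-p : 0ℚ ≤ - p
  0≤-p = neg-antimono-≤ p≤0

½*[p+p]≡p : ∀ p → ½ * (p + p) ≡ p
½*[p+p]≡p p = trans (*-distribˡ-+ ½ p p) (half p)

double-injective : ∀ {p q} → p + p ≡ q + q → p ≡ q
double-injective {p} {q} e = trans (sym (½*[p+p]≡p p)) (trans (cong (½ *_) e) (½*[p+p]≡p q))

inv-distrib-* : ∀ {p q} → 0ℚ < p → 0ℚ < q → inv (p * q) ≡ inv p * inv q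
inv-distrib-* {p} {q} 0<p 0<q = begin
  inv (p * q)
    ≡⟨ sym (trans (cong₂ (λ u v → inv (p * q) * (u * v)) (*-inv 0<p) (*-inv 0<q)) (*-identityʳ _)) ⟩
  inv (p * q) * ((p * inv p) * (q * inv q))
    ≡⟨ solve 5 (λ k p i q j → k :* ((p :* i) :* (q :* j)) := (p :* q :* k) :* (i :* j)) refl
         (inv (p * q)) p (inv p) q (inv q) ⟩
  p * q * inv (p * q) * (inv p * inv q)
    ≡⟨ cong (_* (inv p * inv q)) (*-inv {p * q} (0<* 0<p 0<q)) ⟩
  1ℚ * (inv p * inv q)
    ≡⟨ *-identityˡ _ ⟩
  inv p * inv q ∎
  where open ≡-Reasoning

-- Finite sums, Cauchy-Schwarz and sums over pairs.

sum-scale : ∀ {n} c (f : Fin n → ℚ) → ∑[ i < n ] (c * f i) ≡ c * sum f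
sum-scale c f = sym (*-distribˡ-sum c f)

sum-linear : ∀ {n} a (f : Fin n → ℚ) b g c h →
  ∑[ i < n ] (a * f i + b * g i + c * h i) ≡ a * sum f + b * sum g + c * sum h
sum-linear a f b g c h =
  trans (∑-distrib-+ (λ i → a * f i + b * g i) (λ i → c * h i))
    (cong₂ _+_ (trans (∑-distrib-+ (λ i → a * f i) (λ i → b * g i))
      (cong₂ _+_ (sum-scale a f) (sum-scale b g))) (sum-scale c h))

sum-nonneg : ∀ {n} {f : Fin n → ℚ} → (∀ i → 0ℚ ≤ f i) → 0ℚ ≤ sum f
sum-nonneg {zero}      h = ≤-refl
sum-nonneg {suc n} {f} h = 0≤+ {f Fin.zero} (h Fin.zero) (sum-nonneg (λ i → h (Fin.suc i)))

sum-zeroˡ : ∀ {n} (f : Fin n → ℚ) → ∑[ i < n ] (0ℚ * f i) ≡ 0ℚ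
sum-zeroˡ f = trans (sum-scale 0ℚ f) (*-zeroˡ (sum f))

sum-δ : ∀ {n} (i : Fin n) (f : Fin n → ℚ) →
  ∑[ k < n ] ((if does (i Fin.≟ k) then 1ℚ else 0ℚ) * f k) ≡ f i
sum-δ Fin.zero f = trans (cong₂ _+_ (*-identityˡ (f Fin.zero)) (sum-zeroˡ (λ k → f (Fin.suc k))))
  (+-identityʳ (f Fin.zero))
sum-δ (Fin.suc i) f = trans (cong₂ _+_ (*-zeroˡ (f Fin.zero)) (sum-δ i (λ k → f (Fin.suc k))))
  (+-identityˡ (f (Fin.suc i)))

-- The difference of the two sides is the weighted sum of the squares of t i - μ, where μ is the
-- weighted mean `t̄ * inv (sum w)`.
cauchy-schwarz : ∀ {n} (w t : Fin n → ℚ) → (∀ i → 0ℚ ≤ w i) → 0ℚ < sum w →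
  let t̄ = ∑[ i < n ] (w i * t i) in t̄ * t̄ * inv (sum w) ≤ ∑[ i < n ] (w i * (t i * t i))
cauchy-schwarz w t 0≤w 0<D = ≤-from-gap (≤-trans
  (sum-nonneg λ i → 0≤* {w i} (0≤w i) (0≤square (t i - μ)))
  (≤-reflexive (trans
    (sum-cong-≗ λ i → solve 3 (λ w t μ → w :* ((t :- μ) :* (t :- μ)) :=
        con 1ℚ :* (w :* (t :* t)) :+ (:- (μ :+ μ)) :* (w :* t) :+ μ :* μ :* w) refl (w i) (t i) μ)
    (trans (sum-linear 1ℚ (λ i → w i * (t i * t i)) (- (μ + μ)) (λ i → w i * t i) (μ * μ) w)
    (trans (solve 4 (λ q s i D → con 1ℚ :* q :+ (:- (s :* i :+ s :* i)) :* s :+ s :* i :* (s :* i) :* D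
                             := q :- s :* s :* i :+ s :* s :* i :* (D :* i :- con 1ℚ)) refl
              (sum (λ i → w i * (t i * t i))) T (inv (sum w)) (sum w))
    (trans (cong (λ u → rest + T * T * inv (sum w) * (u - 1ℚ)) (*-inv 0<D))
      (trans (cong (rest +_) (*-zeroʳ (T * T * inv (sum w)))) (+-identityʳ rest))))))))
  where
  T = sum (λ i → w i * t i)
  μ = T * inv (sum w)
  rest = sum (λ i → w i * (t i * t i)) - T * T * inv (sum w)

⟨_,_⟩ : ∀ {n} → (Fin n → ℚ) → (Fin n → ℚ) → ℚ
⟨_,_⟩ {n} f g = ∑[ k < n ] (f k * g k)

-- Trichotomy splits the square into its upper, lower and diagonal parts; exchanging the order of
-- summation reflects the lower part onto the upper one.
∑∑-pairs : ∀ {n} (g : Fin n → Fin n → ℚ) →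
  ∑[ i < n ] ∑[ j < n ] g i j ≡ ∑-pairs (λ i j → g i j + g j i) + ∑[ i < n ] g i i
∑∑-pairs {n} g = begin
  ∑[ i < n ] ∑[ j < n ] g i j
    ≡⟨ sum-cong-≗ (λ i → trans (sum-cong-≗ (trichotomy i))
         (trans (∑-distrib-+ (λ j → up i j + down i j) (diag i))
           (cong₂ _+_ (∑-distrib-+ (up i) (down i)) (sum-δ i (g i))))) ⟩
  ∑[ i < n ] (sum (up i) + sum (down i) + g i i)
    ≡⟨ trans (∑-distrib-+ (λ i → sum (up i) + sum (down i)) (λ i → g i i))
         (cong (_+ sum (λ i → g i i)) (∑-distrib-+ (λ i → sum (up i)) (λ i → sum (down i)))) ⟩
  ∑[ i < n ] sum (up i) + ∑[ i < n ] sum (down i) + ∑[ i < n ] g i i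
    ≡⟨ cong (λ s → ∑[ i < n ] sum (up i) + s + ∑[ i < n ] g i i) (∑-comm down) ⟩
  ∑[ i < n ] sum (up i) + ∑[ i < n ] ∑[ j < n ] down j i + ∑[ i < n ] g i i
    ≡⟨ cong (_+ sum (λ i → g i i)) (sym (trans
         (sum-cong-≗ λ i → trans (sum-cong-≗ (if-+ i)) (∑-distrib-+ (up i) (λ j → down j i)))
         (∑-distrib-+ (λ i → sum (up i)) (λ i → ∑[ j < n ] down j i)))) ⟩
  ∑-pairs (λ i j → g i j + g j i) + ∑[ i < n ] g i i ∎
  where
  open ≡-Reasoning
  up down diag : Fin n → Fin n → ℚ
  up   i j = if does (i Fin.<? j) then g i j else 0ℚ
  down i j = if does (j Fin.<? i) then g i j else 0ℚ
  diag i j = (if does (i Fin.≟ j) then 1ℚ else 0ℚ) * g i j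
  if-+ : ∀ i j → (if does (i Fin.<? j) then g i j + g j i else 0ℚ) ≡ up i j + down j i
  if-+ i j with does (i Fin.<? j)
  ... | true  = refl
  ... | false = refl
  trichotomy : ∀ i j → g i j ≡ up i j + down i j + diag i j
  trichotomy i j with Fin.<-cmp i j
  ... | tri< a b c rewrite dec-true (i Fin.<? j) a | dec-false (i Fin.≟ j) b | dec-false (j Fin.<? i) c
        = solve 1 (λ g → g := g :+ con 0ℚ :+ con 0ℚ :* g) refl (g i j)
  ... | tri≈ a b c rewrite dec-false (i Fin.<? j) a | dec-true (i Fin.≟ j) b | dec-false (j Fin.<? i) c
        = solve 1 (λ g → g := con 0ℚ :+ con 0ℚ :+ con 1ℚ :* g) refl (g i j)
  ... | tri> a b c rewrite dec-false (i Fin.<? j) a | dec-false (i Fin.≟ j) b | dec-true (j Fin.<? i) c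
        = solve 1 (λ g → g := con 0ℚ :+ g :+ con 0ℚ :* g) refl (g i j)

∑-pairs-cong : ∀ {n} {f g : Fin n → Fin n → ℚ} → (∀ i j → f i j ≡ g i j) → ∑-pairs f ≡ ∑-pairs g
∑-pairs-cong e = sum-cong-≗ λ i → sum-cong-≗ λ j →
  cong (if does (i Fin.<? j) then_else 0ℚ) (e i j)

-- The graph Laplacian.

module Laplacian {N : ℕ} (G : SimpleGraph N) where
  open SimpleGraph G

  A : Fin N → Fin N → ℚ
  A i j = if does (i ~? j) then 1ℚ else 0ℚ

  A-sym : ∀ i j → A i j ≡ A j i
  A-sym i j with i ~? j | j ~? i
  ... | yes _ | yes _ = refl
  ... | no  _ | no  _ = refl
  ... | yes e | no ¬e = ⊥-elim (¬e (~-sym e))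
  ... | no ¬e | yes e = ⊥-elim (¬e (~-sym e))

  A-irrefl : ∀ i → A i i ≡ 0ℚ
  A-irrefl i with i ~? i
  ... | yes e = ⊥-elim (~-irrefl e)
  ... | no  _ = refl

  A-idem : ∀ i j → A i j * A i j ≡ A i j
  A-idem i j with does (i ~? j)
  ... | true  = refl
  ... | false = refl

  0≤A : ∀ i j → 0ℚ ≤ A i j
  0≤A i j with does (i ~? j)
  ... | true  = nonNegative⁻¹ 1ℚ
  ... | false = ≤-refl

  if-A : ∀ i j x → (if does (i ~? j) then x else 0ℚ) ≡ A i j * x
  if-A i j x with does (i ~? j)
  ... | true  = sym (*-identityˡ x)
  ... | false = sym (*-zeroˡ x)

  d≡∑A : ∀ i → d G i ≡ sum (A i)
  d≡∑A i = sym (trans (sum-indicator (λ j → does (i ~? j)) 1ℚ) (*-identityʳ _))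

  δ-sym : ∀ i j → δ G i j ≡ δ G j i
  δ-sym i j with i Fin.≟ j | j Fin.≟ i
  ... | yes _ | yes _ = refl
  ... | no  _ | no  _ = refl
  ... | yes e | no ¬e = ⊥-elim (¬e (sym e))
  ... | no ¬e | yes e = ⊥-elim (¬e (sym e))

  δ-idem : ∀ i j → δ G i j * δ G i j ≡ δ G i j
  δ-idem i j with does (i Fin.≟ j)
  ... | true  = refl
  ... | false = refl

  -- There are no loops. Together with `δ-idem` and `A-idem` this removes the quadratic terms when a
  -- combination of `δ G j` and `A j` is squared.
  δ*A : ∀ i j → δ G i j * A i j ≡ 0ℚ
  δ*A i j with i Fin.≟ j
  ... | yes refl = trans (*-identityˡ (A i i)) (A-irrefl i)
  ... | no _     = *-zeroˡ (A i j)

  -- This is D - A written with differences, the form of Kirchhoff's law in `UnitCurrentPotential`;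
  -- additive constants visibly drop out.
  L : (Fin N → ℚ) → Fin N → ℚ
  L z k = ∑[ l < N ] (A k l * (z k - z l))

  potential-L : ∀ {i j v} → UnitCurrentPotential G i j v → ∀ k → L v k ≡ δ G i k - δ G j k
  potential-L {v = v} p k = trans (sum-cong-≗ λ l → sym (if-A k l (v k - v l))) (p k)

  L-cong : ∀ {f g} → (∀ k → f k ≡ g k) → ∀ k → L f k ≡ L g k
  L-cong e k = sum-cong-≗ λ l → cong (A k l *_) (cong₂ _-_ (e k) (e l))

  L-shift : ∀ f c k → L (λ l → f l - c) k ≡ L f k
  L-shift f c k = sum-cong-≗ λ l → cong (A k l *_)
    (solve 3 (λ x y c → x :- c :- (y :- c) := x :- y) refl (f k) (f l) c)

  L-+* : ∀ f c g k → L (λ l → f l + c * g l) k ≡ L f k + c * L g k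
  L-+* f c g k = trans
    (sum-cong-≗ λ l → solve 6 (λ a x y c u v → a :* (x :+ c :* u :- (y :+ c :* v))
        := a :* (x :- y) :+ c :* (a :* (u :- v))) refl (A k l) (f k) (f l) c (g k) (g l))
    (trans (∑-distrib-+ (λ l → A k l * (f k - f l)) (λ l → c * (A k l * (g k - g l))))
      (cong (L f k +_) (sum-scale c (λ l → A k l * (g k - g l)))))

  L-∑ : ∀ {n} (c : Fin n → ℚ) (f : Fin n → Fin N → ℚ) k →
    L (λ l → ∑[ j < n ] (c j * f j l)) k ≡ ∑[ j < n ] (c j * L (f j) k)
  L-∑ {zero}  c f k = trans
    (sum-cong-≗ λ l → solve 1 (λ a → a :* (con 0ℚ :- con 0ℚ) := con 0ℚ :* a) refl (A k l))
    (sum-zeroˡ (A k))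
  L-∑ {suc n} c f k = trans
    (L-cong (λ l → +-comm (c Fin.zero * f Fin.zero l) (rest l)) k)
    (trans (L-+* rest (c Fin.zero) (f Fin.zero) k)
    (trans (+-comm (L rest k) (c Fin.zero * L (f Fin.zero) k))
      (cong (c Fin.zero * L (f Fin.zero) k +_) (L-∑ (λ j → c (Fin.suc j)) (λ j → f (Fin.suc j)) k))))
    where
    rest : Fin N → ℚ
    rest l = ∑[ j < n ] (c (Fin.suc j) * f (Fin.suc j) l)

  L-δ : ∀ j k → L (δ G j) k ≡ δ G j k * d G k - A j k
  L-δ j k = begin
    ∑[ l < N ] (A k l * (δ G j k - δ G j l))
      ≡⟨ sum-cong-≗ (λ l → solve 3 (λ a x y → a :* (x :- y) := x :* a :+ (:- con 1ℚ) :* (y :* a))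
           refl (A k l) (δ G j k) (δ G j l)) ⟩
    ∑[ l < N ] (δ G j k * A k l + (- 1ℚ) * (δ G j l * A k l))
      ≡⟨ ∑-distrib-+ (λ l → δ G j k * A k l) (λ l → (- 1ℚ) * (δ G j l * A k l)) ⟩
    ∑[ l < N ] (δ G j k * A k l) + ∑[ l < N ] ((- 1ℚ) * (δ G j l * A k l))
      ≡⟨ cong₂ _+_ (trans (sum-scale (δ G j k) (A k)) (cong (δ G j k *_) (sym (d≡∑A k))))
           (trans (sum-scale (- 1ℚ) (λ l → δ G j l * A k l))
             (cong ((- 1ℚ) *_) (trans (sum-δ j (A k)) (A-sym k j)))) ⟩
    δ G j k * d G k + (- 1ℚ) * A j k
      ≡⟨ solve 2 (λ x y → x :+ (:- con 1ℚ) :* y := x :- y) refl (δ G j k * d G k) (A j k) ⟩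
    δ G j k * d G k - A j k ∎
    where open ≡-Reasoning

  -- The energy form and the spectral bound.

  energy : (f g : Fin N → ℚ) → ℚ
  energy f g = ∑[ k < N ] ∑[ l < N ] (A k l * ((f k - f l) * (g k - g l)))

  -- By symmetry of `A`, swapping k and l interchanges the two halves of f k - f l. Every edge is
  -- counted in both directions, whence the factor two.
  energy-L : ∀ f g → energy f g ≡ ⟨ f , L g ⟩ + ⟨ f , L g ⟩
  energy-L f g = begin
    energy f g
      ≡⟨ sum-cong-≗ (λ k → trans (sum-cong-≗ (split k)) (∑-distrib-+ (half₁ k) (λ l → half₁ l k))) ⟩
    ∑[ k < N ] (∑[ l < N ] half₁ k l + ∑[ l < N ] half₁ l k)
      ≡⟨ ∑-distrib-+ (λ k → ∑[ l < N ] half₁ k l) (λ k → ∑[ l < N ] half₁ l k) ⟩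
    ∑[ k < N ] ∑[ l < N ] half₁ k l + ∑[ k < N ] ∑[ l < N ] half₁ l k
      ≡⟨ cong₂ _+_ left (trans (∑-comm (λ k l → half₁ l k)) left) ⟩
    ⟨ f , L g ⟩ + ⟨ f , L g ⟩ ∎
    where
    open ≡-Reasoning
    half₁ : Fin N → Fin N → ℚ
    half₁ k l = f k * (A k l * (g k - g l))
    split : ∀ k l → A k l * ((f k - f l) * (g k - g l)) ≡ half₁ k l + half₁ l k
    split k l rewrite A-sym l k =
      solve 5 (λ a x y u v → a :* ((x :- y) :* (u :- v)) := x :* (a :* (u :- v)) :+ y :* (a :* (v :- u)))
        refl (A k l) (f k) (f l) (g k) (g l)
    left : ∑[ k < N ] ∑[ l < N ] half₁ k l ≡ ⟨ f , L g ⟩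
    left = sum-cong-≗ λ k → sum-scale (f k) (λ l → A k l * (g k - g l))

  -- The energy is symmetric in its arguments and is twice either side.
  L-self-adjoint : ∀ f g → ⟨ f , L g ⟩ ≡ ⟨ g , L f ⟩
  L-self-adjoint f g = double-injective (trans (sym (energy-L f g)) (trans
    (sum-cong-≗ λ k → sum-cong-≗ λ l → cong (A k l *_) (*-comm (f k - f l) (g k - g l)))
    (energy-L g f)))

  0≤⟨f,Lf⟩ : ∀ f → 0ℚ ≤ ⟨ f , L f ⟩
  0≤⟨f,Lf⟩ f = ≤-trans
    (0≤* {½} {energy f f} (nonNegative⁻¹ ½) (sum-nonneg λ k → sum-nonneg λ l → 0≤* {A k l} (0≤A k l) (0≤square (f k - f l))))
    (≤-reflexive (trans (cong (½ *_) (energy-L f f)) (½*[p+p]≡p ⟨ f , L f ⟩)))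

  -- The spectrum of the normalized Laplacian is bounded by 2.
  ∑[Lf]²/d≤2⟨f,Lf⟩ : (∀ k → 0ℚ < d G k) → ∀ f →
    ∑[ k < N ] (L f k * L f k * inv (d G k)) ≤ ⟨ f , L f ⟩ + ⟨ f , L f ⟩
  ∑[Lf]²/d≤2⟨f,Lf⟩ 0<d f = ≤-trans
    -- Cauchy-Schwarz at the vertex k, with weights `A k l` of total `d G k` and values f k - f l,
    -- whose weighted sum is `L f k`.
    (sum-mono λ k → subst (λ D → L f k * L f k * inv D ≤ ∑[ l < N ] (A k l * ((f k - f l) * (f k - f l))))
      (sym (d≡∑A k))
      (cauchy-schwarz (A k) (λ l → f k - f l) (0≤A k) (subst (0ℚ <_) (d≡∑A k) (0<d k))))
    (≤-reflexive (energy-L f f))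

  ⟨δ,f⟩ : ∀ j f → ⟨ δ G j , f ⟩ ≡ f j
  ⟨δ,f⟩ j f = sum-δ j f

  -- Self-adjointness makes the two cross terms equal, and pairing `δ G j` with its own Laplacian
  -- gives the degree of j.
  ⟨f+αδ⟩-energy : ∀ f α j → let z = λ l → f l + α * δ G j l in
    ⟨ z , L z ⟩ ≡ ⟨ f , L f ⟩ + (α + α) * L f j + α * α * d G j
  ⟨f+αδ⟩-energy f α j = begin
    ⟨ z , L z ⟩
      ≡⟨ split f z ⟩
    ⟨ f , L z ⟩ + α * L z j
      ≡⟨ cong₂ _+_ (trans (L-self-adjoint f z) (split f f)) (cong (α *_)
           (trans (L-+* f α (δ G j) j) (cong (λ u → L f j + α * u) Lδjj))) ⟩
    ⟨ f , L f ⟩ + α * L f j + α * (L f j + α * d G j)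
      ≡⟨ solve 4 (λ q a l d → q :+ a :* l :+ a :* (l :+ a :* d) := q :+ (a :+ a) :* l :+ a :* a :* d)
           refl ⟨ f , L f ⟩ α (L f j) (d G j) ⟩
    ⟨ f , L f ⟩ + (α + α) * L f j + α * α * d G j ∎
    where
    open ≡-Reasoning
    z : Fin N → ℚ
    z l = f l + α * δ G j l
    split : ∀ g h → ⟨ (λ l → g l + α * δ G j l) , L h ⟩ ≡ ⟨ g , L h ⟩ + α * L h j
    split g h = trans
      (sum-cong-≗ λ k → solve 4 (λ g a e h → (g :+ a :* e) :* h := g :* h :+ a :* (e :* h)) refl
        (g k) α (δ G j k) (L h k))
      (trans (∑-distrib-+ (λ k → g k * L h k) (λ k → α * (δ G j k * L h k)))
        (cong (⟨ g , L h ⟩ +_) (trans (sum-scale α (λ k → δ G j k * L h k)) (cong (α *_) (⟨δ,f⟩ j (L h))))))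
    Lδjj : L (δ G j) j ≡ d G j
    Lδjj = trans (L-δ j j) (trans (cong₂ (λ u v → u * d G j - v) δjj (A-irrefl j))
      (solve 1 (λ d → con 1ℚ :* d :- con 0ℚ := d) refl (d G j)))
      where
      δjj : δ G j j ≡ 1ℚ
      δjj = cong (if_then 1ℚ else 0ℚ) (dec-true (j Fin.≟ j) refl)

  -- The trace of the squared transition matrix.

  d⁻¹ : Fin N → ℚ
  d⁻¹ k = inv (d G k)

  ∑Ad⁻¹ : Fin N → ℚ
  ∑Ad⁻¹ j = ∑[ k < N ] (A j k * d⁻¹ k)

  -- The trace of the square of the normalized adjacency matrix D^(-1/2) A D^(-1/2), free of square
  -- roots.
  ∑d⁻¹Ad⁻¹ : ℚ
  ∑d⁻¹Ad⁻¹ = ∑[ j < N ] (d⁻¹ j * ∑Ad⁻¹ j)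

  P≡A*d⁻¹ : ∀ k l → P G k l ≡ A k l * d⁻¹ k
  P≡A*d⁻¹ k l = if-A k l (d⁻¹ k)

  tr-P² : tr (P G · P G) ≡ ∑d⁻¹Ad⁻¹
  tr-P² = sum-cong-≗ λ k → trans
    (sum-cong-≗ λ l → trans (cong₂ _*_ (P≡A*d⁻¹ k l) (trans (P≡A*d⁻¹ l k) (cong (_* d⁻¹ l) (A-sym l k))))
      (trans (solve 3 (λ a x y → a :* x :* (a :* y) := x :* ((a :* a) :* y)) refl (A k l) (d⁻¹ k) (d⁻¹ l))
        (cong (λ a → d⁻¹ k * (a * d⁻¹ l)) (A-idem k l))))
    (sum-scale (d⁻¹ k) (λ l → A k l * d⁻¹ l))

  -- Positive degrees let the reciprocal of d k * d l factor. Half of the symmetric summand `h` goes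
  -- to each ordering of an edge and the diagonal vanishes, so the sum over edges is half the full
  -- double sum.
  σ²-∑d⁻¹Ad⁻¹ : (∀ k → 0ℚ < d G k) → σ² G ≡ ∑d⁻¹Ad⁻¹ * inv (fromℕ N)
  σ²-∑d⁻¹Ad⁻¹ 0<d = trans (cong (fromℕ 2 * inv (fromℕ N) *_) edges)
    (solve 2 (λ n q → con (fromℕ 2) :* n :* (con ½ :* q) := q :* n) refl (inv (fromℕ N)) ∑d⁻¹Ad⁻¹)
    where
    h : Fin N → Fin N → ℚ
    h k l = d⁻¹ k * (A k l * d⁻¹ l)
    edge : ∀ k l → (if does (k ~? l) then inv (d G k * d G l) else 0ℚ) ≡ ½ * h k l + ½ * h l k
    edge k l = trans (if-A k l (inv (d G k * d G l)))
      (trans (cong (A k l *_) (inv-distrib-* {d G k} {d G l} (0<d k) (0<d l)))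
      (trans (solve 3 (λ a x y → a :* (x :* y) := con ½ :* (x :* (a :* y)) :+ con ½ :* (y :* (a :* x))) refl
               (A k l) (d⁻¹ k) (d⁻¹ l))
        (cong (λ a → ½ * h k l + ½ * (d⁻¹ l * (a * d⁻¹ k))) (A-sym k l))))
    diagonal : ∑[ k < N ] (½ * h k k) ≡ 0ℚ
    diagonal = trans (sum-cong-≗ λ k → trans (cong (λ a → ½ * (d⁻¹ k * (a * d⁻¹ k))) (A-irrefl k))
        (solve 1 (λ x → con ½ :* (x :* (con 0ℚ :* x)) := con 0ℚ :* x) refl (d⁻¹ k))) (sum-zeroˡ d⁻¹)
    edges : ∑-edges G (λ k l → inv (d G k * d G l)) ≡ ½ * ∑d⁻¹Ad⁻¹
    edges = trans (∑-pairs-cong edge) (trans (sym (+-identityʳ _))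
      (trans (cong (∑-pairs (λ k l → ½ * h k l + ½ * h l k) +_) (sym diagonal))
      (trans (sym (∑∑-pairs λ k l → ½ * h k l))
      (trans (sum-cong-≗ λ k → sum-scale ½ (h k))
      (trans (sum-scale ½ (λ k → sum (h k)))
        (cong (½ *_) (sum-cong-≗ λ k → sum-scale (d⁻¹ k) (λ l → A k l * d⁻¹ l))))))))

-- The centred Green function.

module CentredGreenFunction {N : ℕ} (G : SimpleGraph N) (0<d : ∀ k → 0ℚ < d G k) (0<vol : 0ℚ < sum (d G))
  (R : Fin N → Fin N → ℚ) (resistance : ∀ i j → IsEffectiveResistance G i j (R i j)) where
  open Laplacian G

  vol ι : ℚ
  vol = sum (d G)
  ι = inv vol

  -- The stationary distribution of the walk.
  π : Fin N → ℚ
  π k = d G k * ι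

  ∑π≡1 : sum π ≡ 1ℚ
  ∑π≡1 = trans (sum-cong-≗ λ k → *-comm (d G k) ι) (trans (sum-scale ι (d G))
    (trans (*-comm ι vol) (*-inv 0<vol)))

  v : Fin N → Fin N → Fin N → ℚ
  v i j = proj₁ (resistance i j)

  L-v : ∀ i j k → L (v i j) k ≡ δ G i k - δ G j k
  L-v i j = potential-L {i} {j} {v i j} (proj₁ (proj₂ (resistance i j)))

  -- Averaging over the sink j spreads the outgoing current according to `π`. The arbitrary
  -- constants in the potentials only shift `u i` by a constant, which the centring in `W` removes.
  u : Fin N → Fin N → ℚ
  u i k = ∑[ j < N ] (π j * v i j k)

  W : Fin N → Fin N → ℚ
  W i k = u i k - ⟨ π , u i ⟩

  L-W : ∀ i k → L (W i) k ≡ δ G i k - π k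
  L-W i k = begin
    L (W i) k
      ≡⟨ trans (L-shift (u i) ⟨ π , u i ⟩ k) (L-∑ π (v i) k) ⟩
    ∑[ j < N ] (π j * L (v i j) k)
      ≡⟨ sum-cong-≗ (λ j → trans (cong (π j *_) (trans (L-v i j k) (cong (λ e → δ G i k - e) (δ-sym j k))))
           (solve 3 (λ p x y → p :* (x :- y) := x :* p :+ (:- con 1ℚ) :* (y :* p)) refl (π j) (δ G i k) (δ G k j))) ⟩
    ∑[ j < N ] (δ G i k * π j + (- 1ℚ) * (δ G k j * π j))
      ≡⟨ trans (∑-distrib-+ (λ j → δ G i k * π j) (λ j → (- 1ℚ) * (δ G k j * π j)))
           (cong₂ _+_ (trans (sum-scale (δ G i k) π) (cong (δ G i k *_) ∑π≡1))
             (trans (sum-scale (- 1ℚ) (λ j → δ G k j * π j)) (cong ((- 1ℚ) *_) (⟨δ,f⟩ k π)))) ⟩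
    δ G i k * 1ℚ + (- 1ℚ) * π k
      ≡⟨ solve 2 (λ e p → e :* con 1ℚ :+ (:- con 1ℚ) :* p := e :- p) refl (δ G i k) (π k) ⟩
    δ G i k - π k ∎
    where open ≡-Reasoning

  ⟨π,W⟩≡0 : ∀ i → ⟨ π , W i ⟩ ≡ 0ℚ
  ⟨π,W⟩≡0 i = begin
    ⟨ π , W i ⟩
      ≡⟨ sum-cong-≗ (λ k → solve 3 (λ p x c → p :* (x :- c) := p :* x :+ (:- c) :* p) refl (π k) (u i k) c) ⟩
    ∑[ k < N ] (π k * u i k + (- c) * π k)
      ≡⟨ trans (∑-distrib-+ (λ k → π k * u i k) (λ k → (- c) * π k))
           (cong (c +_) (trans (sum-scale (- c) π) (cong ((- c) *_) ∑π≡1))) ⟩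
    c + (- c) * 1ℚ
      ≡⟨ solve 1 (λ c → c :+ (:- c) :* con 1ℚ := con 0ℚ) refl c ⟩
    0ℚ ∎
    where
    open ≡-Reasoning
    c = ⟨ π , u i ⟩

  ∑dW≡0 : ∀ i → ∑[ k < N ] (d G k * W i k) ≡ 0ℚ
  ∑dW≡0 i = begin
    ∑[ k < N ] (d G k * W i k)
      ≡⟨ sum-cong-≗ (λ k → trans (sym (*-identityʳ (d G k * W i k)))
           (trans (cong (d G k * W i k *_) (sym (*-inv 0<vol)))
             (solve 4 (λ d w s i → d :* w :* (s :* i) := s :* (d :* i :* w)) refl (d G k) (W i k) vol ι))) ⟩
    ∑[ k < N ] (vol * (π k * W i k))
      ≡⟨ trans (sum-scale vol (λ k → π k * W i k)) (cong (vol *_) (⟨π,W⟩≡0 i)) ⟩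
    vol * 0ℚ
      ≡⟨ *-zeroʳ vol ⟩
    0ℚ ∎
    where open ≡-Reasoning

  -- A reproducing property: pairing with `L (W j)` evaluates f at j, up to its mean under `π`.
  ⟨f,LW⟩ : ∀ f j → ⟨ f , L (W j) ⟩ ≡ f j - ⟨ π , f ⟩
  ⟨f,LW⟩ f j = begin
    ⟨ f , L (W j) ⟩
      ≡⟨ sum-cong-≗ (λ k → trans (cong (f k *_) (L-W j k))
           (solve 3 (λ f e p → f :* (e :- p) := e :* f :+ (:- con 1ℚ) :* (p :* f)) refl (f k) (δ G j k) (π k))) ⟩
    ∑[ k < N ] (δ G j k * f k + (- 1ℚ) * (π k * f k))
      ≡⟨ trans (∑-distrib-+ (λ k → δ G j k * f k) (λ k → (- 1ℚ) * (π k * f k)))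
           (cong₂ _+_ (⟨δ,f⟩ j f) (sum-scale (- 1ℚ) (λ k → π k * f k))) ⟩
    f j + (- 1ℚ) * ⟨ π , f ⟩
      ≡⟨ solve 2 (λ x y → x :+ (:- con 1ℚ) :* y := x :- y) refl (f j) ⟨ π , f ⟩ ⟩
    f j - ⟨ π , f ⟩ ∎
    where open ≡-Reasoning

  ⟨W,LW⟩ : ∀ i j → ⟨ W i , L (W j) ⟩ ≡ W i j
  ⟨W,LW⟩ i j = trans (⟨f,LW⟩ (W i) j) (trans (cong (λ c → W i j - c) (⟨π,W⟩≡0 i)) (+-identityʳ (W i j)))

  -- By the reproducing property `W` is its own Gram matrix for the symmetric form of `L`.
  W-sym : ∀ i j → W i j ≡ W j i
  W-sym i j = trans (sym (⟨W,LW⟩ i j)) (trans (L-self-adjoint (W i) (W j)) (⟨W,LW⟩ j i))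

  -- Centring `v i j` leaves its potential difference unchanged. Self-adjointness and the
  -- reproducing property evaluate the centred potential at k as `W k i - W k j`.
  resistance-W : ∀ i j → R i j ≡ W i i + W j j - (W i j + W i j)
  resistance-W i j = begin
    R i j
      ≡⟨ proj₂ (proj₂ (resistance i j)) ⟩
    v i j i - v i j j
      ≡⟨ solve 3 (λ x y c → x :- y := x :- c :- (y :- c)) refl (v i j i) (v i j j) ⟨ π , v i j ⟩ ⟩
    (v i j i - ⟨ π , v i j ⟩) - (v i j j - ⟨ π , v i j ⟩)
      ≡⟨ cong₂ _-_ (drop i) (drop j) ⟩
    (W i i - W i j) - (W j i - W j j)
      ≡⟨ cong (λ w → (W i i - W i j) - (w - W j j)) (W-sym j i) ⟩
    (W i i - W i j) - (W i j - W j j)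
      ≡⟨ solve 3 (λ x y w → (x :- w) :- (w :- y) := x :+ y :- (w :+ w)) refl (W i i) (W j j) (W i j) ⟩
    W i i + W j j - (W i j + W i j) ∎
    where
    open ≡-Reasoning
    drop : ∀ k → v i j k - ⟨ π , v i j ⟩ ≡ W k i - W k j
    drop k = trans (sym (⟨f,LW⟩ (v i j) k)) (trans (L-self-adjoint (v i j) (W k)) (trans
      (sum-cong-≗ λ l → trans (cong (W k l *_) (L-v i j l))
        (solve 3 (λ w x y → w :* (x :- y) := x :* w :+ (:- con 1ℚ) :* (y :* w)) refl (W k l) (δ G i l) (δ G j l)))
      (trans (∑-distrib-+ (λ l → δ G i l * W k l) (λ l → (- 1ℚ) * (δ G j l * W k l)))
      (trans (cong₂ _+_ (⟨δ,f⟩ i (W k)) (trans (sum-scale (- 1ℚ) (λ l → δ G j l * W k l))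
               (cong ((- 1ℚ) *_) (⟨δ,f⟩ j (W k)))))
        (solve 2 (λ x y → x :+ (:- con 1ℚ) :* y := x :- y) refl (W k i) (W k j))))))

  -- The index as a sum of two traces.

  ∑dW : ℚ
  ∑dW = ∑[ j < N ] (d G j * W j j)

  ∑W : ℚ
  ∑W = ∑[ j < N ] W j j

  -- Symmetry of R and its zero diagonal turn the sum over pairs into the full double sum of d i * R
  -- i j. After inserting `resistance-W` the mixed terms vanish, because each `W j` is orthogonal to
  -- the degree vector.
  R⁺-W : R⁺ G R ≡ fromℕ N * ∑dW + vol * ∑W
  R⁺-W = begin
    R⁺ G R
      ≡⟨ trans (∑-pairs-cong λ i j → trans (*-distribʳ-+ (R i j) (d G i) (d G j))
           (cong (λ r → d G i * R i j + d G j * r) (R-sym i j))) (sym (+-identityʳ _)) ⟩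
    ∑-pairs (λ i j → d G i * R i j + d G j * R j i) + 0ℚ
      ≡⟨ trans (cong (∑-pairs (λ i j → d G i * R i j + d G j * R j i) +_) (sym diagonal))
           (sym (∑∑-pairs λ i j → d G i * R i j)) ⟩
    ∑[ i < N ] ∑[ j < N ] (d G i * R i j)
      ≡⟨ sum-cong-≗ row ⟩
    ∑[ i < N ] (fromℕ N * (d G i * W i i) + ∑W * d G i + (- fromℕ 2) * (d G i * sum (W i)))
      ≡⟨ sum-linear (fromℕ N) (λ i → d G i * W i i) ∑W (d G) (- fromℕ 2) (λ i → d G i * sum (W i)) ⟩
    fromℕ N * ∑dW + ∑W * vol + (- fromℕ 2) * ∑[ i < N ] (d G i * sum (W i))
      ≡⟨ cong₂ (λ x y → fromℕ N * ∑dW + x + (- fromℕ 2) * y) (*-comm ∑W vol) cross ⟩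
    fromℕ N * ∑dW + vol * ∑W + (- fromℕ 2) * 0ℚ
      ≡⟨ +-identityʳ _ ⟩
    fromℕ N * ∑dW + vol * ∑W ∎
    where
    open ≡-Reasoning
    R-sym : ∀ i j → R i j ≡ R j i
    R-sym i j = trans (resistance-W i j) (trans
      (cong₂ (λ x w → x - (w + w)) (+-comm (W i i) (W j j)) (W-sym i j)) (sym (resistance-W j i)))
    diagonal : ∑[ i < N ] (d G i * R i i) ≡ 0ℚ
    diagonal = trans (sum-cong-≗ λ i → trans (cong (d G i *_)
        (trans (resistance-W i i) (+-inverseʳ (W i i + W i i))))
      (trans (*-zeroʳ (d G i)) (sym (*-zeroˡ (d G i))))) (sum-zeroˡ (d G))
    row : ∀ i → ∑[ j < N ] (d G i * R i j) ≡
      fromℕ N * (d G i * W i i) + ∑W * d G i + (- fromℕ 2) * (d G i * sum (W i))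
    row i = trans
      (sum-cong-≗ λ j → trans (cong (d G i *_) (resistance-W i j))
        (solve 4 (λ d x y w → d :* (x :+ y :- (w :+ w)) :=
           d :* x :* con 1ℚ :+ d :* y :+ (:- con (fromℕ 2)) :* d :* w) refl (d G i) (W i i) (W j j) (W i j)))
      (trans (sum-linear (d G i * W i i) (λ _ → 1ℚ) (d G i) (λ j → W j j) ((- fromℕ 2) * d G i) (W i))
      (trans (cong (λ n → d G i * W i i * n + d G i * ∑W + (- fromℕ 2) * d G i * sum (W i)) (sum-one N))
        (solve 5 (λ d w n s t → d :* w :* n :+ d :* s :+ (:- con (fromℕ 2)) :* d :* t :=
            n :* (d :* w) :+ s :* d :+ (:- con (fromℕ 2)) :* (d :* t)) refl
          (d G i) (W i i) (fromℕ N) ∑W (sum (W i)))))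
    cross : ∑[ i < N ] (d G i * sum (W i)) ≡ 0ℚ
    cross = trans (sum-cong-≗ λ i → sym (sum-scale (d G i) (W i)))
      (trans (∑-comm (λ i j → d G i * W i j))
      (trans (sum-cong-≗ λ j → trans (sum-cong-≗ λ i → cong (d G i *_) (W-sym i j))
          (trans (∑dW≡0 j) (sym (*-zeroˡ (d G j)))))
        (sum-zeroˡ (d G))))

  -- Trial vectors and Dirichlet's principle.

  δ-refl : ∀ j → δ G j j ≡ 1ℚ
  δ-refl j = cong (if_then 1ℚ else 0ℚ) (dec-true (j Fin.≟ j) refl)

  -- This quadratic in α serves twice: with one α for all j in `vol*∑W≥m²`, and with α depending on
  -- j in `row-bound`.
  ⟨W+αδ⟩-energy : ∀ α j → let z = λ l → W j l + α * δ G j l in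
    ⟨ z , L z ⟩ ≡ W j j + (α + α) * (1ℚ - π j) + α * α * d G j
  ⟨W+αδ⟩-energy α j = trans (⟨f+αδ⟩-energy (W j) α j)
    (cong₂ (λ w x → w + (α + α) * x + α * α * d G j) (⟨W,LW⟩ j j)
      (trans (L-W j j) (cong (λ e → e - π j) (δ-refl j))))

  -- The trace of the identity minus a projection of rank one, so m counts the nonzero eigenvalues.
  -- Introducing m by an equation avoids truncated subtraction.
  sum-1-π : ∀ {m} → fromℕ N ≡ 1ℚ + m → ∑[ j < N ] (1ℚ - π j) ≡ m
  sum-1-π {m} n≡1+m = begin
    ∑[ j < N ] (1ℚ - π j)
      ≡⟨ sum-cong-≗ (λ j → solve 1 (λ p → con 1ℚ :- p := con 1ℚ :+ (:- con 1ℚ) :* p) refl (π j)) ⟩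
    ∑[ j < N ] (1ℚ + (- 1ℚ) * π j)
      ≡⟨ trans (∑-distrib-+ (λ _ → 1ℚ) (λ j → (- 1ℚ) * π j))
           (cong₂ _+_ (trans (sum-one N) n≡1+m) (trans (sum-scale (- 1ℚ) π) (cong ((- 1ℚ) *_) ∑π≡1))) ⟩
    1ℚ + m + (- 1ℚ) * 1ℚ
      ≡⟨ solve 1 (λ m → con 1ℚ :+ m :+ (:- con 1ℚ) :* con 1ℚ := m) refl m ⟩
    m ∎
    where open ≡-Reasoning

  -- Dirichlet's principle for the potentials W j, tested against multiples of δ j.
  vol*∑W≥m² : ∀ {m} → fromℕ N ≡ 1ℚ + m → m * m ≤ vol * ∑W
  vol*∑W≥m² {m} n≡1+m = ≤-from-gap (≤-trans
    (0≤* {vol} (<⇒≤ 0<vol) (sum-nonneg λ j → 0≤⟨f,Lf⟩ (λ l → W j l + α * δ G j l)))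
    (≤-reflexive (begin
      vol * ∑[ j < N ] ⟨ (λ l → W j l + α * δ G j l) , L (λ l → W j l + α * δ G j l) ⟩
        ≡⟨ cong (vol *_) (trans
             (sum-cong-≗ λ j → trans (⟨W+αδ⟩-energy α j)
               (cong (λ w → w + (α + α) * (1ℚ - π j) + α * α * d G j) (sym (*-identityˡ (W j j)))))
             (trans (sum-linear 1ℚ (λ j → W j j) (α + α) (λ j → 1ℚ - π j) (α * α) (d G))
               (cong (λ x → 1ℚ * ∑W + (α + α) * x + α * α * vol) (sum-1-π n≡1+m)))) ⟩
      vol * (1ℚ * ∑W + (α + α) * m + α * α * vol)
        ≡⟨ solve 4 (λ w V i m → V :* (con 1ℚ :* w :+ ((:- (m :* i)) :+ (:- (m :* i))) :* m :+ (:- (m :* i)) :* (:- (m :* i)) :* V)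
             := V :* w :- (V :* i) :* (m :* m :+ m :* m) :+ (V :* i) :* (V :* i) :* (m :* m)) refl ∑W vol ι m ⟩
      vol * ∑W - (vol * ι) * (m * m + m * m) + (vol * ι) * (vol * ι) * (m * m)
        ≡⟨ cong (λ t → vol * ∑W - t * (m * m + m * m) + t * t * (m * m)) (*-inv 0<vol) ⟩
      vol * ∑W - 1ℚ * (m * m + m * m) + 1ℚ * 1ℚ * (m * m)
        ≡⟨ solve 2 (λ w m → w :- con 1ℚ :* (m :* m :+ m :* m) :+ con 1ℚ :* con 1ℚ :* (m :* m) := w :- m :* m)
             refl (vol * ∑W) m ⟩
      vol * ∑W - m * m ∎)))
    where
    open ≡-Reasoning
    -- The minimizer of ∑W + 2 α m + α² vol, the total energy of the trial vectors.
    α = - (m * ι)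

  -- Second moments and Kemeny's constant.

  d*d⁻¹≡1 : ∀ k → d G k * d⁻¹ k ≡ 1ℚ
  d*d⁻¹≡1 k = *-inv (0<d k)

  -- In `L z` the vertex j has coefficient β and its neighbours have - α, while `π` is subtracted
  -- everywhere. The first two supports are disjoint, so only products with `π` survive as cross
  -- terms; dividing by the degree turns `π` into `ι`.
  ∑[L[W+αδ]]²/d : ∀ α j → let z = λ l → W j l + α * δ G j l; β = 1ℚ + α * d G j in
    ∑[ k < N ] (L z k * L z k * d⁻¹ k) ≡
    (β * β * d⁻¹ j - (β + β) * ι) + (α * α * ∑Ad⁻¹ j + (α + α) * ι * d G j) + ι
  ∑[L[W+αδ]]²/d α j = begin
    ∑[ k < N ] (L z k * L z k * d⁻¹ k)
      ≡⟨ sum-cong-≗ (λ k → trans (cong (λ x → x * x * d⁻¹ k) (L-z k)) (expand k)) ⟩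
    ∑[ k < N ] (1ℚ * (δ G j k * F k) + 1ℚ * (A j k * H k) + ι * π k)
      ≡⟨ sum-linear 1ℚ (λ k → δ G j k * F k) 1ℚ (λ k → A j k * H k) ι π ⟩
    1ℚ * ∑[ k < N ] (δ G j k * F k) + 1ℚ * ∑[ k < N ] (A j k * H k) + ι * sum π
      ≡⟨ cong₂ _+_ (cong₂ (λ x y → 1ℚ * x + 1ℚ * y) (⟨δ,f⟩ j F) ∑AH) (cong (ι *_) ∑π≡1) ⟩
    1ℚ * F j + 1ℚ * (α * α * ∑Ad⁻¹ j + (α + α) * ι * d G j) + ι * 1ℚ
      ≡⟨ solve 3 (λ x y z → con 1ℚ :* x :+ con 1ℚ :* y :+ z :* con 1ℚ := x :+ y :+ z) refl
           (F j) (α * α * ∑Ad⁻¹ j + (α + α) * ι * d G j) ι ⟩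
    F j + (α * α * ∑Ad⁻¹ j + (α + α) * ι * d G j) + ι ∎
    where
    open ≡-Reasoning
    z F H : Fin N → ℚ
    z l = W j l + α * δ G j l
    F k = (1ℚ + α * d G k) * (1ℚ + α * d G k) * d⁻¹ k - ((1ℚ + α * d G k) + (1ℚ + α * d G k)) * ι
    H k = α * α * d⁻¹ k + (α + α) * ι
    L-z : ∀ k → L z k ≡ δ G j k - π k + α * (δ G j k * d G k - A j k)
    L-z k = trans (L-+* (W j) α (δ G j) k) (cong₂ (λ x y → x + α * y) (L-W j k) (L-δ j k))
    -- The first four arguments stand for the products δ², A², δ A and d d⁻¹. The square is expanded
    -- as a polynomial identity with these products intact; then they are replaced by δ, A, 0 and 1.
    Φ : ℚ → ℚ → ℚ → ℚ → Fin N → ℚ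
    Φ e² a² ea di k = e² * (β * β * d⁻¹ k) + α * α * a² * d⁻¹ k + ι * ι * d G k * di
      - (α + α) * β * ea * d⁻¹ k + (α + α) * ι * A j k * di - (β + β) * ι * δ G j k * di
      where β = 1ℚ + α * d G k
    expand : ∀ k → let x = δ G j k - π k + α * (δ G j k * d G k - A j k) in
      x * x * d⁻¹ k ≡ 1ℚ * (δ G j k * F k) + 1ℚ * (A j k * H k) + ι * π k
    expand k = trans
      (solve 6 (λ e a d i ι α → let β = con 1ℚ :+ α :* d; x = e :- d :* ι :+ α :* (e :* d :- a) in
        x :* x :* i := e :* e :* (β :* β :* i) :+ α :* α :* (a :* a) :* i :+ ι :* ι :* d :* (d :* i)
          :- (α :+ α) :* β :* (e :* a) :* i :+ (α :+ α) :* ι :* a :* (d :* i) :- (β :+ β) :* ι :* e :* (d :* i))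
        refl (δ G j k) (A j k) (d G k) (d⁻¹ k) ι α)
      (trans (cong₂ (λ x y → Φ x y (δ G j k * A j k) (d G k * d⁻¹ k) k) (δ-idem j k) (A-idem j k))
      (trans (cong₂ (λ x y → Φ (δ G j k) (A j k) x y k) (δ*A j k) (d*d⁻¹≡1 k))
      (solve 6 (λ e a d i ι α → let β = con 1ℚ :+ α :* d in
        e :* (β :* β :* i) :+ α :* α :* a :* i :+ ι :* ι :* d :* con 1ℚ
          :- (α :+ α) :* β :* con 0ℚ :* i :+ (α :+ α) :* ι :* a :* con 1ℚ :- (β :+ β) :* ι :* e :* con 1ℚ
        := con 1ℚ :* (e :* (β :* β :* i :- (β :+ β) :* ι)) :+ con 1ℚ :* (a :* (α :* α :* i :+ (α :+ α) :* ι)) :+ ι :* (d :* ι))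
        refl (δ G j k) (A j k) (d G k) (d⁻¹ k) ι α)))
    ∑AH : ∑[ k < N ] (A j k * H k) ≡ α * α * ∑Ad⁻¹ j + (α + α) * ι * d G j
    ∑AH = trans (sum-cong-≗ λ k → solve 4 (λ a i ι α → a :* (α :* α :* i :+ (α :+ α) :* ι)
            := α :* α :* (a :* i) :+ (α :+ α) :* ι :* a) refl (A j k) (d⁻¹ k) ι α)
      (trans (∑-distrib-+ (λ k → α * α * (A j k * d⁻¹ k)) (λ k → (α + α) * ι * A j k))
        (cong₂ _+_ (sum-scale (α * α) (λ k → A j k * d⁻¹ k))
          (trans (sum-scale ((α + α) * ι) (A j)) (cong ((α + α) * ι *_) (sym (d≡∑A j))))))

  -- Summed over j, this is (1 - b y)² ≤ 2 (1 - b y)² / y, summed over the nonzero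
  -- eigenvalues y of the normalized Laplacian.
  row-bound : ∀ b j → let x = d G j * W j j - (b + b) * (1ℚ - π j) + b * b in
    (1ℚ - b) * (1ℚ - b) - π j + b * b * (d⁻¹ j * ∑Ad⁻¹ j) ≤ x + x
  row-bound b j = ≤-trans (≤-reflexive (sym left)) (≤-trans
    (*-monoˡ {d G j} (<⇒≤ (0<d j)) (≤-trans
      (≤-reflexive (sym (∑[L[W+αδ]]²/d α j)))
      (∑[Lf]²/d≤2⟨f,Lf⟩ 0<d (λ l → W j l + α * δ G j l))))
    (≤-reflexive (trans (cong (λ e → d G j * (e + e)) (⟨W+αδ⟩-energy α j)) right)))
    where
    -- This makes the trial vector the column j of W - b D⁻¹, which in normalized coordinates has
    -- the eigenvalue 1 / y - b for each nonzero y. The factor d j applied above turns sums over j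
    -- into traces.
    α = - (b * d⁻¹ j)
    β = 1ℚ + α * d G j
    left : d G j * ((β * β * d⁻¹ j - (β + β) * ι) + (α * α * ∑Ad⁻¹ j + (α + α) * ι * d G j) + ι)
      ≡ (1ℚ - b) * (1ℚ - b) - π j + b * b * (d⁻¹ j * ∑Ad⁻¹ j)
    left = trans
      (solve 5 (λ d i ι b s → let α = :- (b :* i); β = con 1ℚ :+ α :* d; γ = con 1ℚ :- b :* (d :* i) in
        d :* ((β :* β :* i :- (β :+ β) :* ι) :+ (α :* α :* s :+ (α :+ α) :* ι :* d) :+ ι)
        := γ :* γ :* (d :* i) :- (γ :+ γ) :* (d :* ι) :+ b :* b :* (i :* s) :* (d :* i)
           :- (b :+ b) :* (d :* ι) :* (d :* i) :+ d :* ι) refl (d G j) (d⁻¹ j) ι b (∑Ad⁻¹ j))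
      (trans (cong (λ t → (1ℚ - b * t) * (1ℚ - b * t) * t - ((1ℚ - b * t) + (1ℚ - b * t)) * π j
            + b * b * (d⁻¹ j * ∑Ad⁻¹ j) * t - (b + b) * π j * t + π j) (d*d⁻¹≡1 j))
      (solve 3 (λ b p s → let γ = con 1ℚ :- b :* con 1ℚ in
        γ :* γ :* con 1ℚ :- (γ :+ γ) :* p :+ b :* b :* s :* con 1ℚ :- (b :+ b) :* p :* con 1ℚ :+ p
        := (con 1ℚ :- b) :* (con 1ℚ :- b) :- p :+ b :* b :* s) refl b (π j) (d⁻¹ j * ∑Ad⁻¹ j)))
    right : let e = W j j + (α + α) * (1ℚ - π j) + α * α * d G j
                x = d G j * W j j - (b + b) * (1ℚ - π j) + b * b in d G j * (e + e) ≡ x + x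
    right = trans
      (solve 5 (λ d i p b w → let α = :- (b :* i); e = w :+ (α :+ α) :* (con 1ℚ :- p) :+ α :* α :* d
                                  x = d :* w :- (b :+ b) :* (con 1ℚ :- p) :* (d :* i) :+ b :* b :* (d :* i) :* (d :* i) in
        d :* (e :+ e) := x :+ x) refl (d G j) (d⁻¹ j) (π j) b (W j j))
      (trans (cong (λ t → let x = d G j * W j j - (b + b) * (1ℚ - π j) * t + b * b * t * t in x + x) (d*d⁻¹≡1 j))
      (solve 4 (λ d p b w → let x = d :* w :- (b :+ b) :* (con 1ℚ :- p) :* con 1ℚ :+ b :* b :* con 1ℚ :* con 1ℚ
                                y = d :* w :- (b :+ b) :* (con 1ℚ :- p) :+ b :* b in
        x :+ x := y :+ y) refl (d G j) (π j) b (W j j)))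

  -- `∑dW` is Kemeny's constant of the walk, the sum of 1 / y over the nonzero eigenvalues y.
  -- Summing `row-bound` over j bounds it from below by the moments of y, of which the second enters
  -- through `∑d⁻¹Ad⁻¹`.
  kemeny-bound : ∀ {m s} → fromℕ N ≡ 1ℚ + m → 0ℚ < fromℕ N → ∑d⁻¹Ad⁻¹ ≡ fromℕ N * s →
    m * m + ½ * (m * (m * s - 1ℚ)) ≤ fromℕ N * ∑dW
  kemeny-bound {m} {s} n≡1+m 0<n Q≡ns = ≤-from-gap (≤-trans
    (0≤* {½} (nonNegative⁻¹ ½) (0≤* {n} (<⇒≤ 0<n) (gap-nonneg summed)))
    (≤-reflexive (trans (cong (λ q → ½ * (n * (X + X - (n * ((1ℚ - b) * (1ℚ - b)) + (- 1ℚ) * 1ℚ + b * b * q)))) Q≡ns)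
    (trans (cong (½ *_) (solve 5 (λ n y m k s → let b = m :* y; t = n :* y
                                                    x = con 1ℚ :* k :+ (:- (b :+ b)) :* m :+ b :* b :* n in
      n :* (x :+ x :- (n :* ((con 1ℚ :- b) :* (con 1ℚ :- b)) :+ (:- con 1ℚ) :* con 1ℚ :+ b :* b :* (n :* s)))
      := n :* k :+ n :* k :- con (fromℕ 4) :* m :* m :* t :+ con (fromℕ 2) :* m :* m :* t :* t
         :- (n :- m :* t) :* (n :- m :* t) :+ n :- m :* m :* s :* t :* t) refl n (inv n) m ∑dW s))
    (trans (cong (λ t → ½ * (n * ∑dW + n * ∑dW - fromℕ 4 * m * m * t + fromℕ 2 * m * m * t * t
         - (n - m * t) * (n - m * t) + n - m * m * s * t * t)) (*-inv 0<n))
    (trans (cong (λ n′ → ½ * (n * ∑dW + n * ∑dW - fromℕ 4 * m * m * 1ℚ + fromℕ 2 * m * m * 1ℚ * 1ℚ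
         - (n′ - m * 1ℚ) * (n′ - m * 1ℚ) + n′ - m * m * s * 1ℚ * 1ℚ)) n≡1+m)
    (solve 3 (λ K m s → con ½ :* (K :+ K :- con (fromℕ 4) :* m :* m :* con 1ℚ :+ con (fromℕ 2) :* m :* m :* con 1ℚ :* con 1ℚ
         :- (con 1ℚ :+ m :- m :* con 1ℚ) :* (con 1ℚ :+ m :- m :* con 1ℚ) :+ (con 1ℚ :+ m) :- m :* m :* s :* con 1ℚ :* con 1ℚ)
      := K :- (m :* m :+ con ½ :* (m :* (m :* s :- con 1ℚ)))) refl (n * ∑dW) m s)))))))
    where
    n = fromℕ N
    -- Hence 1 - b = 1 / n, and the summed inequality times n / 2 is the claimed bound.
    b = m * inv n
    X = 1ℚ * ∑dW + (- (b + b)) * m + b * b * n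
    sumˡ : ∑[ j < N ] ((1ℚ - b) * (1ℚ - b) - π j + b * b * (d⁻¹ j * ∑Ad⁻¹ j)) ≡
      n * ((1ℚ - b) * (1ℚ - b)) + (- 1ℚ) * 1ℚ + b * b * ∑d⁻¹Ad⁻¹
    sumˡ = trans
      (sum-cong-≗ λ j → solve 3 (λ c p q → c :- p :+ q := c :* con 1ℚ :+ (:- con 1ℚ) :* p :+ q) refl
        ((1ℚ - b) * (1ℚ - b)) (π j) (b * b * (d⁻¹ j * ∑Ad⁻¹ j)))
      (trans (sum-linear ((1ℚ - b) * (1ℚ - b)) (λ _ → 1ℚ) (- 1ℚ) π (b * b) (λ j → d⁻¹ j * ∑Ad⁻¹ j))
        (cong₂ (λ x y → x + (- 1ℚ) * y + b * b * ∑d⁻¹Ad⁻¹)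
          (trans (cong ((1ℚ - b) * (1ℚ - b) *_) (sum-one N)) (*-comm ((1ℚ - b) * (1ℚ - b)) n)) ∑π≡1))
    sumʳ : ∑[ j < N ] (d G j * W j j - (b + b) * (1ℚ - π j) + b * b) ≡ X
    sumʳ = trans
      (sum-cong-≗ λ j → solve 4 (λ x c p e → x :- c :* p :+ e := con 1ℚ :* x :+ (:- c) :* p :+ e :* con 1ℚ) refl
        (d G j * W j j) (b + b) (1ℚ - π j) (b * b))
      (trans (sum-linear 1ℚ (λ j → d G j * W j j) (- (b + b)) (λ j → 1ℚ - π j) (b * b) (λ _ → 1ℚ))
        (cong₂ (λ x y → 1ℚ * ∑dW + (- (b + b)) * x + b * b * y) (sum-1-π n≡1+m) (sum-one N)))
    summed : n * ((1ℚ - b) * (1ℚ - b)) + (- 1ℚ) * 1ℚ + b * b * ∑d⁻¹Ad⁻¹ ≤ X + X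
    summed = ≤-trans (≤-reflexive (sym sumˡ)) (≤-trans (sum-mono λ j → row-bound b j)
      (≤-reflexive (trans (∑-distrib-+ (λ j → d G j * W j j - (b + b) * (1ℚ - π j) + b * b)
                                       (λ j → d G j * W j j - (b + b) * (1ℚ - π j) + b * b))
        (cong₂ _+_ sumʳ sumʳ))))

-- Degree bounds in a connected graph.

another : ∀ {N} → 2 ℕ.≤ N → (k : Fin N) → ∃ λ j → k ≢ j
another (ℕ.s≤s (ℕ.s≤s _)) Fin.zero    = Fin.suc Fin.zero , λ ()
another (ℕ.s≤s (ℕ.s≤s _)) (Fin.suc k) = Fin.zero , λ ()

fromℕ-pred : ∀ {N} → 2 ℕ.≤ N → fromℕ N ≡ 1ℚ + fromℕ (N ∸ 1)
fromℕ-pred (ℕ.s≤s {n = n} _) = fromℕ-suc n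

module DegreeBounds {N : ℕ} (2≤N : 2 ℕ.≤ N) (G : SimpleGraph N) (connected : Connected G) where
  open SimpleGraph G
  open Laplacian G

  m : ℚ
  m = fromℕ (N ∸ 1)

  0<N : 0ℚ < fromℕ N
  0<N = <-≤-trans (positive⁻¹ (fromℕ 2)) (fromℕ-mono 2≤N)

  1≤m : 1ℚ ≤ m
  1≤m = fromℕ-mono (ℕ.∸-monoˡ-≤ 1 2≤N)

  -- A path to a second vertex is not empty, and its first edge ends at a neighbour.
  neighbour : ∀ k → ∃ λ l → k ~ l
  neighbour k with another 2≤N k
  ... | j , k≢j with connected k j
  ...   | Star.ε               = ⊥-elim (k≢j refl)
  ...   | Star._◅_ {j = l} e _ = l , e

  1≤d : ∀ k → 1ℚ ≤ d G k
  1≤d k with neighbour k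
  ... | l , e = begin
    1ℚ                          ≡⟨ sym A≡1 ⟩
    A k l                       ≡⟨ sym (⟨δ,f⟩ l (A k)) ⟩
    ⟨ δ G l , A k ⟩             ≤⟨ sum-mono (λ j → term j) ⟩
    sum (A k)                   ≡⟨ sym (d≡∑A k) ⟩
    d G k                       ∎
    where
    open ≤-Reasoning
    A≡1 : A k l ≡ 1ℚ
    A≡1 = cong (if_then 1ℚ else 0ℚ) (dec-true (k ~? l) e)
    term : ∀ j → δ G l j * A k j ≤ A k j
    term j with does (l Fin.≟ j)
    ... | true  = ≤-reflexive (*-identityˡ (A k j))
    ... | false = ≤-trans (≤-reflexive (*-zeroˡ (A k j))) (0≤A k j)

  0<d : ∀ k → 0ℚ < d G k
  0<d k = <-≤-trans (positive⁻¹ 1ℚ) (1≤d k)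

  0<vol : 0ℚ < sum (d G)
  0<vol = <-≤-trans 0<N (≤-trans (≤-reflexive (sym (sum-one N))) (sum-mono 1≤d))

  -- Without loops the row `A k` is dominated by 1 - δ k, whose sum is N - 1.
  d≤m : ∀ k → d G k ≤ m
  d≤m k = begin
    d G k                              ≡⟨ d≡∑A k ⟩
    sum (A k)                          ≤⟨ sum-mono (λ l → term l) ⟩
    ∑[ l < N ] (1ℚ + (- 1ℚ) * (δ G k l * 1ℚ))
      ≡⟨ trans (∑-distrib-+ (λ _ → 1ℚ) (λ l → (- 1ℚ) * (δ G k l * 1ℚ)))
           (cong₂ _+_ (trans (sum-one N) (fromℕ-pred 2≤N))
             (trans (sum-scale (- 1ℚ) (λ l → δ G k l * 1ℚ)) (cong ((- 1ℚ) *_) (⟨δ,f⟩ k (λ _ → 1ℚ))))) ⟩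
    1ℚ + m + (- 1ℚ) * 1ℚ               ≡⟨ solve 1 (λ m → con 1ℚ :+ m :+ (:- con 1ℚ) :* con 1ℚ := m) refl m ⟩
    m                                  ∎
    where
    open ≤-Reasoning
    term : ∀ l → A k l ≤ 1ℚ + (- 1ℚ) * (δ G k l * 1ℚ)
    term l with k Fin.≟ l
    ... | yes refl = ≤-reflexive (A-irrefl k)
    ... | no _ with does (k ~? l)
    ...   | true  = ≤-refl
    ...   | false = nonNegative⁻¹ 1ℚ

  0≤d⁻¹ : ∀ k → 0ℚ ≤ d⁻¹ k
  0≤d⁻¹ k = 0≤inv (<⇒≤ (0<d k))

  1≤m*d⁻¹ : ∀ k → 1ℚ ≤ m * d⁻¹ k
  1≤m*d⁻¹ k = ≤-trans (≤-reflexive (sym (*-inv (0<d k)))) (*-monoʳ {d⁻¹ k} (0≤d⁻¹ k) (d≤m k))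

  d⁻¹≤1 : ∀ k → d⁻¹ k ≤ 1ℚ
  d⁻¹≤1 k = inv≤ {d G k} {1ℚ} (0<d k) (≤-trans (1≤d k) (≤-reflexive (sym (*-identityʳ (d G k)))))

  d≤m*∑Ad⁻¹ : ∀ k → d G k ≤ m * ∑Ad⁻¹ k
  d≤m*∑Ad⁻¹ k = ≤-trans (≤-reflexive (d≡∑A k)) (≤-trans
    (sum-mono λ l → ≤-trans (≤-reflexive (sym (*-identityʳ (A k l))))
      (≤-trans (*-monoˡ {A k l} (0≤A k l) (1≤m*d⁻¹ l))
        (≤-reflexive (solve 3 (λ a m i → a :* (m :* i) := m :* (a :* i)) refl (A k l) m (d⁻¹ l)))))
    (≤-reflexive (sum-scale m (λ l → A k l * d⁻¹ l))))

  ∑Ad⁻¹≤d : ∀ k → ∑Ad⁻¹ k ≤ d G k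
  ∑Ad⁻¹≤d k = ≤-trans (sum-mono λ l → ≤-trans (*-monoˡ {A k l} (0≤A k l) (d⁻¹≤1 l)) (≤-reflexive (*-identityʳ (A k l))))
    (≤-reflexive (sym (d≡∑A k)))

  d⁻¹*d≡1 : ∀ k → d⁻¹ k * d G k ≡ 1ℚ
  d⁻¹*d≡1 k = trans (*-comm (d⁻¹ k) (d G k)) (*-inv (0<d k))

  -- Degrees at most m make every neighbour contribute at least 1 / m to `∑Ad⁻¹ k`, so each row of
  -- the double sum is at least 1 / m. This becomes σ² ≥ 1 / m.
  N≤m*∑d⁻¹Ad⁻¹ : fromℕ N ≤ m * ∑d⁻¹Ad⁻¹
  N≤m*∑d⁻¹Ad⁻¹ = ≤-trans (≤-reflexive (sym (sum-one N))) (≤-trans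
    (sum-mono λ k → ≤-trans (≤-reflexive (sym (d⁻¹*d≡1 k))) (≤-trans (*-monoˡ {d⁻¹ k} (0≤d⁻¹ k) (d≤m*∑Ad⁻¹ k))
      (≤-reflexive (solve 3 (λ i m s → i :* (m :* s) := m :* (i :* s)) refl (d⁻¹ k) m (∑Ad⁻¹ k)))))
    (≤-reflexive (sum-scale m (λ k → d⁻¹ k * ∑Ad⁻¹ k))))

  -- Degrees at least 1 make each row of the double sum at most 1. This becomes σ² ≤ 1.
  ∑d⁻¹Ad⁻¹≤N : ∑d⁻¹Ad⁻¹ ≤ fromℕ N
  ∑d⁻¹Ad⁻¹≤N = ≤-trans
    (sum-mono λ k → ≤-trans (*-monoˡ {d⁻¹ k} (0≤d⁻¹ k) (∑Ad⁻¹≤d k)) (≤-reflexive (d⁻¹*d≡1 k)))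
    (≤-reflexive (sum-one N))

  ∑d⁻¹Ad⁻¹≡N*σ² : ∑d⁻¹Ad⁻¹ ≡ fromℕ N * σ² G
  ∑d⁻¹Ad⁻¹≡N*σ² = sym (trans (cong (fromℕ N *_) (σ²-∑d⁻¹Ad⁻¹ 0<d)) (*-cancel-inv ∑d⁻¹Ad⁻¹ 0<N))

  1≤m*σ² : 1ℚ ≤ m * σ² G
  1≤m*σ² = *-cancelˡ-≤-pos (fromℕ N) {{positive 0<N}} (≤-trans (≤-reflexive (*-identityʳ (fromℕ N)))
    (≤-trans N≤m*∑d⁻¹Ad⁻¹ (≤-reflexive (trans (cong (m *_) ∑d⁻¹Ad⁻¹≡N*σ²)
      (solve 3 (λ m n s → m :* (n :* s) := n :* (m :* s)) refl m (fromℕ N) (σ² G))))))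

  σ²≤1 : σ² G ≤ 1ℚ
  σ²≤1 = *-cancelˡ-≤-pos (fromℕ N) {{positive 0<N}} (≤-trans (≤-reflexive (sym ∑d⁻¹Ad⁻¹≡N*σ²))
    (≤-trans ∑d⁻¹Ad⁻¹≤N (≤-reflexive (sym (*-identityʳ (fromℕ N))))))

  R⁺-bound : (R : Fin N → Fin N → ℚ) → (∀ i j → IsEffectiveResistance G i j (R i j)) →
    m * m + ½ * (m * (m * σ² G - 1ℚ)) + m * m ≤ R⁺ G R
  R⁺-bound R resistance = ≤-trans
    (+-mono-≤ (kemeny-bound {m} {σ² G} (fromℕ-pred 2≤N) 0<N ∑d⁻¹Ad⁻¹≡N*σ²) (vol*∑W≥m² {m} (fromℕ-pred 2≤N)))
    (≤-reflexive (sym R⁺-W))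
    where open CentredGreenFunction G 0<d 0<vol R resistance

-- Rational estimates of the bracket.

1≤x+e : ∀ {x e} → 0ℚ ≤ x → 0ℚ ≤ e → 1ℚ ≤ x * x + e → 1ℚ ≤ x + e
1≤x+e {x} {e} 0≤x 0≤e h with ≤-total x 1ℚ
-- Here x * x ≤ x, so the error e carries over unchanged.
... | inj₁ x≤1 = ≤-trans h (+-monoˡ-≤ e (≤-trans (*-monoˡ {x} 0≤x x≤1) (≤-reflexive (*-identityʳ x))))
... | inj₂ 1≤x = ≤-trans 1≤x (p≤p+q {x} {e} 0≤e)

square≤1⇒≤1 : ∀ {x} → 0ℚ ≤ x → x * x ≤ 1ℚ → x ≤ 1ℚ
square≤1⇒≤1 {x} 0≤x h = ≮⇒≥ λ 1<x → <-irrefl refl (<-≤-trans 1<x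
  (≤-trans (≤-reflexive (sym (*-identityʳ x))) (≤-trans (*-monoˡ {x} 0≤x (<⇒≤ 1<x)) h)))

inv≤1 : ∀ {p} → 1ℚ ≤ p → inv p ≤ 1ℚ
inv≤1 {p} 1≤p = inv≤ {p} {1ℚ} (<-≤-trans (positive⁻¹ 1ℚ) 1≤p) (≤-trans 1≤p (≤-reflexive (sym (*-identityʳ p))))

-- The bracket of the lower bound exceeds its value m² / (m + 1)
-- at s = 1 / m by a term of second order in m s - 1.
bracket-excess : ∀ k s → 0ℚ < 1ℚ + s → 0ℚ < 1ℚ + k - s → let m = 1ℚ + k in
  (1ℚ + m) * (1ℚ * inv (1ℚ + s) + k * k * inv (m - s)) ≡
  m * m + (m * s - 1ℚ) * (m * s - 1ℚ) * (inv (1ℚ + s) * inv (m - s))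
bracket-excess k s 0<1+s 0<m-s = begin
  (1ℚ + m) * (1ℚ * a + k * k * b)
    -- Both fractions are brought over the common denominator (1 + s) (m - s).
    ≡⟨ cong ((1ℚ + m) *_) (cong₂ (λ x y → x * a + k * k * y) (sym (*-inv 0<m-s))
         (trans (sym (*-identityˡ b)) (cong (_* b) (sym (*-inv 0<1+s))))) ⟩
  (1ℚ + m) * ((m - s) * b * a + k * k * ((1ℚ + s) * a * b))
    ≡⟨ solve 4 (λ k s a b → let m = con 1ℚ :+ k; x = m :* s :- con 1ℚ in
         (con 1ℚ :+ m) :* ((m :- s) :* b :* a :+ k :* k :* ((con 1ℚ :+ s) :* a :* b))
         := m :* m :* ((con 1ℚ :+ s) :* a) :* ((m :- s) :* b) :+ x :* x :* (a :* b)) refl k s a b ⟩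
  m * m * ((1ℚ + s) * a) * ((m - s) * b) + x * x * (a * b)
    ≡⟨ cong (_+ x * x * (a * b)) (trans (cong₂ (λ u v → m * m * u * v) (*-inv 0<1+s) (*-inv 0<m-s))
         (trans (*-identityʳ (m * m * 1ℚ)) (*-identityʳ (m * m)))) ⟩
  m * m + x * x * (a * b) ∎
  where
  m = 1ℚ + k
  a = inv (1ℚ + s)
  b = inv (m - s)
  x = m * s - 1ℚ
  open ≡-Reasoning

-- ρ and t stand for approximations from below, with error η in the square, to
-- √m and σ = √S.
module Approximation {m S ρ t η : ℚ} (1≤m : 1ℚ ≤ m) (1≤mS : 1ℚ ≤ m * S) (S≤1 : S ≤ 1ℚ)
  (0≤ρ : 0ℚ ≤ ρ) (0≤t : 0ℚ ≤ t) (0≤η : 0ℚ ≤ η) (η≤½ : η ≤ ½)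
  (ρ²≤m : ρ * ρ ≤ m) (m≤ρ²+η : m ≤ ρ * ρ + η) (t²≤S : t * t ≤ S) (S≤t²+η : S ≤ t * t + η) where

  s : ℚ
  s = t * inv ρ

  0≤m : 0ℚ ≤ m
  0≤m = ≤-trans (nonNegative⁻¹ 1ℚ) 1≤m

  -- The margin ½ absorbs the error η.
  ρ²-lower : ∀ {c} → c + ½ ≤ m → c ≤ ρ * ρ
  ρ²-lower {c} h = ≤-from-gap (≤-trans (gap-nonneg (≤-trans h (≤-trans m≤ρ²+η (+-monoʳ-≤ (ρ * ρ) η≤½))))
    (≤-reflexive (solve 3 (λ r h c → r :+ h :- (c :+ h) := r :- c) refl (ρ * ρ) ½ c)))

  0<ρ : 0ℚ < ρ
  0<ρ = sq-cancel-< {0ℚ} {ρ} 0≤ρ (<-≤-trans (positive⁻¹ ½) (ρ²-lower {½} 1≤m))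

  0≤s : 0ℚ ≤ s
  0≤s = 0≤* {t} {inv ρ} 0≤t (<⇒≤ (0<inv 0<ρ))

  s²ρ²≡t² : s * s * (ρ * ρ) ≡ t * t
  s²ρ²≡t² = trans (solve 3 (λ t i r → t :* i :* (t :* i) :* (r :* r) := t :* t :* ((r :* i) :* (r :* i))) refl t (inv ρ) ρ)
    (trans (cong (λ x → t * t * (x * x)) (*-inv 0<ρ)) (*-identityʳ (t * t)))

  0≤mη : 0ℚ ≤ m * η
  0≤mη = 0≤* {m} {η} 0≤m 0≤η

  -- For exact roots (m s)² = m S ≥ 1. The approximations lose at most m η in the square, and
  -- `1≤x+e` passes from the square to m s with the same error.
  1≤ms+mη : 1ℚ ≤ m * s + m * η
  1≤ms+mη = 1≤x+e (0≤* {m} {s} 0≤m 0≤s) 0≤mη (begin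
    1ℚ                                  ≤⟨ 1≤mS ⟩
    m * S                               ≤⟨ *-monoˡ {m} 0≤m S≤t²+η ⟩
    m * (t * t + η)                     ≡⟨ cong (λ x → m * (x + η)) (sym s²ρ²≡t²) ⟩
    m * (s * s * (ρ * ρ) + η)           ≤⟨ *-monoˡ {m} 0≤m (+-monoˡ-≤ η (*-monoˡ {s * s} (0≤square s) ρ²≤m)) ⟩
    m * (s * s * m + η)                 ≡⟨ solve 3 (λ m s e → m :* (s :* s :* m :+ e) := m :* s :* (m :* s) :+ m :* e) refl m s η ⟩
    m * s * (m * s) + m * η             ∎)
    where open ≤-Reasoning

  module _ (2≤m : fromℕ 2 ≤ m) where
    open ≤-Reasoning

    s²≤1 : s * s ≤ 1ℚ
    s²≤1 = begin
      s * s               ≡⟨ sym (*-identityʳ (s * s)) ⟩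
      s * s * 1ℚ          ≤⟨ *-monoˡ {s * s} (0≤square s) (ρ²-lower {1ℚ} (≤-trans (≤ᵇ⇒≤ {1ℚ + ½} {fromℕ 2} _) 2≤m)) ⟩
      s * s * (ρ * ρ)     ≡⟨ s²ρ²≡t² ⟩
      t * t               ≤⟨ ≤-trans t²≤S S≤1 ⟩
      1ℚ                  ∎

    s≤1 : s ≤ 1ℚ
    s≤1 = square≤1⇒≤1 0≤s s²≤1

    [ms]²≤ : m * s * (m * s) ≤ m * (S + η)
    [ms]²≤ = begin
      m * s * (m * s)                  ≡⟨ solve 2 (λ m s → m :* s :* (m :* s) := m :* (s :* s :* m)) refl m s ⟩
      m * (s * s * m)                  ≤⟨ *-monoˡ {m} 0≤m (*-monoˡ {s * s} (0≤square s) m≤ρ²+η) ⟩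
      m * (s * s * (ρ * ρ + η))        ≡⟨ cong (m *_) (trans (*-distribˡ-+ (s * s) (ρ * ρ) η) (cong (_+ s * s * η) s²ρ²≡t²)) ⟩
      m * (t * t + s * s * η)          ≤⟨ *-monoˡ {m} 0≤m (+-mono-≤ t²≤S
                                            (≤-trans (*-monoʳ {η} 0≤η s²≤1) (≤-reflexive (*-identityˡ η)))) ⟩
      m * (S + η)                      ∎

    -- For exact roots (m s - 1)² = (m s)² - 1 - 2 (m s - 1) ≤ m S - 1, and 2 ≤ m supplies the
    -- factor ½ m. The error is m η from `[ms]²≤` plus 2 m η from `1≤ms+mη`.
    [ms-1]²≤ : (m * s - 1ℚ) * (m * s - 1ℚ) ≤ ½ * (m * (m * S - 1ℚ)) + fromℕ 3 * m * η
    [ms-1]²≤ = begin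
      (m * s - 1ℚ) * (m * s - 1ℚ)
        ≡⟨ solve 2 (λ x e → (x :- con 1ℚ) :* (x :- con 1ℚ)
             := x :* x :- con 1ℚ :+ (e :+ e) :- con (fromℕ 2) :* (x :+ e :- con 1ℚ)) refl (m * s) (m * η) ⟩
      m * s * (m * s) - 1ℚ + (m * η + m * η) - fromℕ 2 * (m * s + m * η - 1ℚ)
        ≤⟨ +-mono-≤ (+-monoˡ-≤ (m * η + m * η) (+-monoˡ-≤ (- 1ℚ) [ms]²≤))
             (neg-antimono-≤ (0≤* {fromℕ 2} (0≤fromℕ 2) (gap-nonneg 1≤ms+mη))) ⟩
      m * (S + η) - 1ℚ + (m * η + m * η) + - 0ℚ
        ≡⟨ solve 3 (λ m S e → m :* (S :+ e) :- con 1ℚ :+ (m :* e :+ m :* e) :+ con 0ℚ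
             := con ½ :* (con (fromℕ 2) :* (m :* S :- con 1ℚ)) :+ con (fromℕ 3) :* m :* e) refl m S η ⟩
      ½ * (fromℕ 2 * (m * S - 1ℚ)) + fromℕ 3 * m * η
        ≤⟨ +-monoˡ-≤ (fromℕ 3 * m * η) (*-monoˡ {½} (nonNegative⁻¹ ½) (*-monoʳ {m * S - 1ℚ} (gap-nonneg 1≤mS) 2≤m)) ⟩
      ½ * (m * (m * S - 1ℚ)) + fromℕ 3 * m * η ∎

    -- Since 2 ≤ m and s ≤ 1, both reciprocals in the excess term are at most 1, which leaves (m s -
    -- 1)².
    bracket≤ : ∀ {n k} → n ≡ 1ℚ + m → m ≡ 1ℚ + k →
      n * (1ℚ * inv (1ℚ + s) + k * k * inv (m - s)) ≤
      m * m + ½ * (m * (m * S - 1ℚ)) + fromℕ 3 * m * η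
    bracket≤ {n} {k} refl refl = begin
      n * (1ℚ * inv (1ℚ + s) + k * k * inv (m - s))
        ≡⟨ bracket-excess k s (<-≤-trans (positive⁻¹ 1ℚ) 1≤1+s) (<-≤-trans (positive⁻¹ 1ℚ) 1≤m-s) ⟩
      m * m + x * x * (inv (1ℚ + s) * inv (m - s))
        ≤⟨ +-monoʳ-≤ (m * m) (*-monoˡ {x * x} (0≤square x)
             (*-mono {inv (1ℚ + s)} {1ℚ} {inv (m - s)} {1ℚ}
               (0≤inv (≤-trans (nonNegative⁻¹ 1ℚ) 1≤m-s)) (nonNegative⁻¹ 1ℚ) (inv≤1 1≤1+s) (inv≤1 1≤m-s))) ⟩
      m * m + x * x * (1ℚ * 1ℚ)
        ≡⟨ cong (m * m +_) (*-identityʳ (x * x)) ⟩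
      m * m + x * x
        ≤⟨ +-monoʳ-≤ (m * m) [ms-1]²≤ ⟩
      m * m + (½ * (m * (m * S - 1ℚ)) + fromℕ 3 * m * η)
        ≡⟨ sym (+-assoc (m * m) (½ * (m * (m * S - 1ℚ))) (fromℕ 3 * m * η)) ⟩
      m * m + ½ * (m * (m * S - 1ℚ)) + fromℕ 3 * m * η ∎
      where
      x = m * s - 1ℚ
      1≤1+s : 1ℚ ≤ 1ℚ + s
      1≤1+s = p≤p+q {1ℚ} {s} 0≤s
      1≤m-s : 1ℚ ≤ m - s
      1≤m-s = +-mono-≤ {fromℕ 2} {m} { - 1ℚ} { - s} 2≤m (neg-antimono-≤ s≤1)

-- The case N = 2, where the second fraction is absent.
bracket₂≤ : ∀ {s η} → 0ℚ ≤ s → 0ℚ ≤ η → 1ℚ ≤ 1ℚ * s + 1ℚ * η →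
  fromℕ 2 * (1ℚ * inv (1ℚ + s) + 0ℚ) ≤ 1ℚ + η
bracket₂≤ {s} {η} 0≤s 0≤η h = begin
  fromℕ 2 * (1ℚ * inv (1ℚ + s) + 0ℚ)
    ≤⟨ *-monoˡ {fromℕ 2} (0≤fromℕ 2) (+-monoˡ-≤ 0ℚ (*-monoˡ {1ℚ} (nonNegative⁻¹ 1ℚ)
         (inv≤ {1ℚ + s} {½ * (1ℚ + η)} (<-≤-trans (positive⁻¹ 1ℚ) (p≤p+q {1ℚ} {s} 0≤s)) 1≤))) ⟩
  fromℕ 2 * (1ℚ * (½ * (1ℚ + η)) + 0ℚ)
    ≡⟨ solve 1 (λ e → con (fromℕ 2) :* (con 1ℚ :* (con ½ :* (con 1ℚ :+ e)) :+ con 0ℚ) := con 1ℚ :+ e) refl η ⟩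
  1ℚ + η ∎
  where
  open ≤-Reasoning
  -- The hypothesis h gives s + η ≥ 1, and (1 + s) (1 + η) exceeds 1 + s + η by s η.
  1≤ : 1ℚ ≤ (1ℚ + s) * (½ * (1ℚ + η))
  1≤ = begin
    1ℚ                                          ≤⟨ ≤ᵇ⇒≤ {1ℚ} {½ * (1ℚ + 1ℚ)} _ ⟩
    ½ * (1ℚ + 1ℚ)                               ≤⟨ *-monoˡ {½} (nonNegative⁻¹ ½) (+-monoʳ-≤ 1ℚ h) ⟩
    ½ * (1ℚ + (1ℚ * s + 1ℚ * η))                ≤⟨ *-monoˡ {½} (nonNegative⁻¹ ½)
                                                     (p≤p+q {1ℚ + (1ℚ * s + 1ℚ * η)} {s * η} (0≤* {s} {η} 0≤s 0≤η)) ⟩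
    ½ * (1ℚ + (1ℚ * s + 1ℚ * η) + s * η)        ≡⟨ solve 2 (λ s e → con ½ :* (con 1ℚ :+ (con 1ℚ :* s :+ con 1ℚ :* e) :+ s :* e)
                                                     := (con 1ℚ :+ s) :* (con ½ :* (con 1ℚ :+ e))) refl s η ⟩
    (1ℚ + s) * (½ * (1ℚ + η))                   ∎

-- Passage to the real bound.

√-seq-square≤ : ∀ {q} → 0ℚ ≤ q → ∀ n → seq (√ q) n * seq (√ q) n ≤ q
√-seq-square≤ {q} 0≤q n = ≤-trans (Bisection.lower²≤q (0ℚ ⊔ q) (p≤p⊔q 0ℚ q) n)
  (≤-reflexive (p≤q⇒p⊔q≡q 0≤q))

0<⊓ : ∀ {p q} → 0ℚ < p → 0ℚ < q → 0ℚ < p ⊓ q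
0<⊓ {p} {q} 0<p 0<q with ⊓-sel p q
... | inj₁ e = subst (0ℚ <_) (sym e) 0<p
... | inj₂ e = subst (0ℚ <_) (sym e) 0<q

module LowerBound {N : ℕ} (2≤N : 2 ℕ.≤ N) (G : SimpleGraph N) (connected : Connected G) where
  open DegreeBounds 2≤N G connected

  0≤m : 0ℚ ≤ m
  0≤m = 0≤fromℕ (N ∸ 1)

  0≤σ² : 0ℚ ≤ σ² G
  0≤σ² = *-cancelˡ-≤-pos m {{positive (<-≤-trans (positive⁻¹ 1ℚ) 1≤m)}}
    (≤-trans (≤-reflexive (*-zeroʳ m)) (≤-trans (nonNegative⁻¹ 1ℚ) 1≤m*σ²))

  module Error (ε : ℚ) (0<ε : 0ℚ < ε) where
    3m : ℚ
    3m = fromℕ 3 * m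

    0<3m : 0ℚ < 3m
    0<3m = 0<* {fromℕ 3} {m} (positive⁻¹ (fromℕ 3)) (<-≤-trans (positive⁻¹ 1ℚ) 1≤m)

    η : ℚ
    -- The bound ½ is required by `Approximation`; the other one keeps the accumulated error 3 m η
    -- below ε.
    η = ½ ⊓ (ε * inv 3m)

    0<η : 0ℚ < η
    0<η = 0<⊓ {½} {ε * inv 3m} (positive⁻¹ ½) (0<* {ε} {inv 3m} 0<ε (0<inv 0<3m))

    3mη≤ε : 3m * η ≤ ε
    3mη≤ε = ≤-trans (*-monoˡ {3m} (<⇒≤ 0<3m) (p⊓q≤q ½ (ε * inv 3m))) (≤-reflexive (*-cancel-inv ε 0<3m))

    -- The second half of `√-square` eventually bounds the radicand by the squared approximation
    -- plus η; the reverse bound holds at every index by `√-seq-square≤`.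
    √m-close = proj₂ (√-square m 0≤m) η 0<η
    σ-close  = proj₂ (√-square (σ² G) 0≤σ²) η 0<η

    K : ℕ
    K = proj₁ √m-close ℕ.⊔ proj₁ σ-close

    module At (n : ℕ) (K≤n : K ℕ.≤ n) = Approximation {m} {σ² G} {seq (√[N-1] 2≤N) n} {seq (σ G) n} {η}
      1≤m 1≤m*σ² σ²≤1 (√-seq-nonneg m n) (√-seq-nonneg (σ² G) n) (<⇒≤ 0<η) (p⊓q≤p ½ (ε * inv 3m))
      (√-seq-square≤ 0≤m n) (proj₂ √m-close n (ℕ.m⊔n≤o⇒m≤o (proj₁ √m-close) (proj₁ σ-close) K≤n))
      (√-seq-square≤ 0≤σ² n) (proj₂ σ-close n (ℕ.m⊔n≤o⇒n≤o (proj₁ √m-close) (proj₁ σ-close) K≤n))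

-- Each term of the sequence of `lowerBound` unfolds to the rational expression estimated above, so
-- it remains to pass beyond K and to use 3 m η ≤ ε.
lowerBound≤ : ∀ {N} (2≤N : 2 ℕ.≤ N) (G : SimpleGraph N) → Connected G → let m = fromℕ (N ∸ 1) in
  lowerBound 2≤N G ≤ᵣ fromℚ (m * m + ½ * (m * (m * σ² G - 1ℚ)) + m * m)
lowerBound≤ {suc zero} (ℕ.s≤s ()) _ _
-- For two vertices m computes to 1 and the second fraction to 0; the term ½ m (m σ² - 1) enters
-- through its nonnegativity.
lowerBound≤ {suc (suc zero)} 2≤N G connected ε 0<ε = K , λ n K≤n → ≤-trans
  (+-monoˡ-≤ (m * m) (bracket₂≤ {At.s n K≤n} {η} (At.0≤s n K≤n) (<⇒≤ 0<η) (At.1≤ms+mη n K≤n)))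
  (begin
    1ℚ + η + 1ℚ * 1ℚ
      ≤⟨ +-monoˡ-≤ (1ℚ * 1ℚ) (+-mono-≤ {1ℚ} {1ℚ * 1ℚ + ½ * (m * (m * σ² G - 1ℚ))} {η} {ε}
           (p≤p+q {1ℚ * 1ℚ} {½ * (m * (m * σ² G - 1ℚ))}
             (0≤* {½} (nonNegative⁻¹ ½) (0≤* {m} 0≤m (gap-nonneg 1≤m*σ²))))
           (≤-trans (≤-trans (≤-reflexive (sym (*-identityˡ η)))
             (*-monoʳ {η} {1ℚ} {3m} (<⇒≤ 0<η) (≤ᵇ⇒≤ {1ℚ} {3m} _))) 3mη≤ε)) ⟩
    1ℚ * 1ℚ + ½ * (m * (m * σ² G - 1ℚ)) + ε + 1ℚ * 1ℚ
      ≡⟨ solve 3 (λ a e b → a :+ e :+ b := a :+ b :+ e) refl (1ℚ * 1ℚ + ½ * (m * (m * σ² G - 1ℚ))) ε (1ℚ * 1ℚ) ⟩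
    1ℚ * 1ℚ + ½ * (m * (m * σ² G - 1ℚ)) + 1ℚ * 1ℚ + ε ∎)
  where
  open ≤-Reasoning
  open DegreeBounds 2≤N G connected
  open LowerBound 2≤N G connected
  open Error ε 0<ε
lowerBound≤ {suc (suc (suc k))} 2≤N G connected ε 0<ε = K , λ n K≤n → begin
  seq (lowerBound 2≤N G) n
    ≤⟨ +-monoˡ-≤ (m * m) (At.bracket≤ n K≤n (fromℕ-mono {2} {suc (suc k)} (ℕ.s≤s (ℕ.s≤s ℕ.z≤n)))
         {fromℕ (suc (suc (suc k)))} {fromℕ (suc k)} (fromℕ-suc (suc (suc k))) (fromℕ-suc (suc k))) ⟩
  B + 3m * η + m * m
    ≤⟨ +-monoˡ-≤ (m * m) (+-monoʳ-≤ B 3mη≤ε) ⟩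
  B + ε + m * m
    ≡⟨ solve 3 (λ a e b → a :+ e :+ b := a :+ b :+ e) refl B ε (m * m) ⟩
  B + m * m + ε ∎
  where
  open ≤-Reasoning
  open DegreeBounds 2≤N G connected
  open LowerBound 2≤N G connected
  open Error ε 0<ε
  B = m * m + ½ * (m * (m * σ² G - 1ℚ))

theorem5 : (N : ℕ) (2≤N : 2 ℕ.≤ N) (G : SimpleGraph N) → Connected G →
    (R : Fin N → Fin N → ℚ) → (∀ i j → IsEffectiveResistance G i j (R i j)) →
    (σ² G ≡ tr (P G · P G) * inv (fromℕ N)) ×
    (lowerBound 2≤N G ≤ᵣ fromℚ (R⁺ G R))
theorem5 N 2≤N G connected R resistance =
  trans (σ²-∑d⁻¹Ad⁻¹ 0<d) (cong (_* inv (fromℕ N)) (sym tr-P²)) ,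
  -- The comparison with `R⁺` is between rationals and independent of n, so the same K serves.
  λ ε 0<ε → let K , bound = lowerBound≤ 2≤N G connected ε 0<ε in
    K , λ n K≤n → ≤-trans (bound n K≤n) (+-monoˡ-≤ ε (R⁺-bound R resistance))
  where
  open Laplacian G
  open DegreeBounds 2≤N G connected
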